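{- Let $G$ be a connected circle graph on $n$ vertices. Then the partial Petrial polynomial $P_G^{\times}(z)$ is binomial if and only if $G$ is a path.
   Context: All graphs are finite. A path on $n\ge 1$ vertices is the simple graph with vertices $v_1,\dots,v_n$ and edges $v_iv_{i+1}$ for $1\le i\le n-1$ (a single vertex is a path). A ribbon graph $R$ is a (orientable or non-orientable) surface with boundary, represented as the union of two sets of topological discs, a set $V(R)$ of vertices and a set $E(R)$ of edges, such that: (1) the vertices and edges intersect in disjoint line segments; (2) each such line segment lies on the boundary of precisely one vertex and precisely one edge; (3) every edge contains exactly two such line segments. For a ribbon graph $R$, let $v(R)$, $e(R)$, $c(R)$, $f(R)$ be the numbers of vertices, edges, connected components and boundary components of $R$. The Euler characteristic is $\chi(R)=v(R)-e(R)+f(R)$, and the Euler genus is $\varepsilon(R)=2c(R)-\chi(R)$. For $A\subseteq E(R)$, the partial Petrial $R^{\times|A}$ is the ribbon graph obtained from $R$ by adding a half-twist to each edge in $A$ (that is, for each edge in $A$, detach one end from its incident vertex disc, give the edge a half-twist, and reattach the end). The partial Petrial polynomial of $R$ is ${}^{\partial}\varepsilon^{\times}_{R}(z):=\sum_{A\subseteq E(R)}z^{\varepsilon(R^{\times|A})}$. A bouquet is a ribbon graph with exactly one vertex; all of its edges are loops. Two loops of a bouquet are interlaced if their ends are met in an alternating order when travelling round the boundary of the vertex. The intersection graph $I(B)$ of a bouquet $B$ is the simple graph with vertex set $E(B)$ in which two vertices $e_1,e_2$ are adjacent if and only if $e_1$ and $e_2$ are interlaced in $B$. A graph is a circle graph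 if it is (isomorphic to) the intersection graph of a bouquet. The partial Petrial polynomial of a circle graph $G$ is $P_G^{\times}(z):={}^{\partial}\varepsilon^{\times}_{B}(z)$, where $B$ is any bouquet whose intersection graph is isomorphic to $G$; it is known that this does not depend on the choice of $B$. A polynomial is binomial if it contains exactly two non-zero terms, i.e. it is of the form $az^k+bz^m$ with $k\ne m$ and $a,b\neq 0$. -}

module Defs where

open import Data.Bool.Base using (Bool; true; false; not; _xor_; if_then_else_)
import Data.Bool.Properties as Bool
open import Data.Fin.Base using (Fin; toℕ)
import Data.Fin.Properties as Fin
open import Data.Fin.Subset using (Subset; inside; outside)
open import Data.Integer.Base as ℤ using (ℤ; +_)
import Data.Integer.Properties as ℤ
open import Data.List.Base
  using (List; []; _∷_; _++_; map; foldr; length; deduplicate; allFin;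
         cartesianProduct; cartesianProductWith)
open import Data.List.Membership.Propositional using (_∈_; find)
open import Data.List.Membership.Propositional.Properties
  using (∈-cartesianProduct⁺; ∈-cartesianProductWith⁺; ∈-cartesianProductWith⁻; ∈-allFin)
open import Data.List.Relation.Unary.Any as Any using (Any; here; there)
open import Data.Nat.Base using (ℕ; zero; suc; _+_; _*_; _<_; _≥_)
open import Data.Nat.GeneralisedArithmetic using (iterate)
import Data.Nat.Properties as ℕ
open import Data.Product.Base using (Σ; ∃-syntax; _×_; _,_; proj₁)
import Data.Product.Properties as Product
open import Data.Sum.Base using (_⊎_; inj₁; inj₂; swap)
import Data.Vec.Base as Vec
open import Function.Base using (_∘_)
open import Function.Bundles using (_↔_; _⇔_; Inverse)
open import Relation.Binary.Construct.Closure.Equivalence as Eq using (EqClosure)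
open import Relation.Binary.Construct.Closure.ReflexiveTransitive using (Star; ε)
open import Relation.Binary.Definitions using (Decidable; DecidableEquality)
open import Relation.Binary.PropositionalEquality
  using (_≡_; _≢_; refl; sym; trans; cong)
open import Relation.Binary.Structures using (IsEquivalence)
open import Relation.Nullary.Decidable using (does; map′; _×-dec_; _⊎-dec_)
open import Relation.Nullary.Negation using (¬_)

------------------------------------------------------------------------
-- Simple graphs

record SimpleGraph (n : ℕ) : Set₁ where
  field
    Adj    : Fin n → Fin n → Set
    symm   : ∀ {u v} → Adj u v → Adj v u
    irrefl : ∀ {u} → ¬ Adj u u

open SimpleGraph public using (Adj)

infix 4 _≅_

_≅_ : ∀ {m n} → SimpleGraph m → SimpleGraph n → Set
_≅_ {m} {n} G H =
  Σ (Fin m ↔ Fin n) λ φ → ∀ u v → Adj G u v ⇔ Adj H (Inverse.to φ u) (Inverse.to φ v)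

Connected : ∀ {n} → SimpleGraph n → Set
Connected G = ∀ u v → Star (Adj G) u v

pathGraph : (n : ℕ) → SimpleGraph n
pathGraph n = record
  { Adj    = λ i j → toℕ j ≡ suc (toℕ i) ⊎ toℕ i ≡ suc (toℕ j)
  ; symm   = swap
  ; irrefl = λ { (inj₁ p) → ℕ.1+n≢n (sym p) ; (inj₂ p) → ℕ.1+n≢n (sym p) }
  }

IsPath : ∀ {n} → SimpleGraph n → Set
IsPath G = ∃[ k ] k ≥ 1 × G ≅ pathGraph k

------------------------------------------------------------------------
-- Orbits of a list of permutations of a finite type

module Orbits {A : Set} (_≟_ : DecidableEquality A)
              (elements : List A) (complete : ∀ x → x ∈ elements) where

  Linked : List (A × A) → A → A → Set
  Linked ps = EqClosure (λ x y → (x , y) ∈ ps)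

  module _ {ps : List (A × A)} {a b : A} where

    private
      L : A → A → Set
      L = Linked ps

      open IsEquivalence (Eq.isEquivalence (λ x y → (x , y) ∈ ps))
        renaming (refl to L-refl; sym to L-sym; trans to L-trans)

      M : A → Set
      M x = L x a ⊎ L x b

      M-resp : ∀ {x y} → L x y → M y → M x
      M-resp p (inj₁ q) = inj₁ (L-trans p q)
      M-resp p (inj₂ q) = inj₂ (L-trans p q)

      J : A → A → Set
      J x y = L x y ⊎ (M x × M y)

      J-isEquivalence : IsEquivalence J
      J-isEquivalence = record
        { refl  = inj₁ L-refl
        ; sym   = λ { (inj₁ p) → inj₁ (L-sym p) ; (inj₂ (p , q)) → inj₂ (q , p) }
        ; trans = λ { (inj₁ p)       (inj₁ q)       → inj₁ (L-trans p q)
                    ; (inj₁ p)       (inj₂ (q , r)) → inj₂ (M-resp p q , r)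
                    ; (inj₂ (p , q)) (inj₁ r)       → inj₂ (p , M-resp (L-sym r) q)
                    ; (inj₂ (p , _)) (inj₂ (_ , r)) → inj₂ (p , r) }
        }

      J⁺ : ∀ {x y} → (x , y) ∈ (a , b) ∷ ps → J x y
      J⁺ (here refl) = inj₂ (inj₁ L-refl , inj₂ L-refl)
      J⁺ (there i)   = inj₁ (Eq.return i)

      R : A → A → Set
      R x y = (x , y) ∈ (a , b) ∷ ps

      M⇒a : ∀ {x} → M x → Linked ((a , b) ∷ ps) x a
      M⇒a (inj₁ p) = Eq.map there p
      M⇒a (inj₂ p) =
        Eq.transitive R (Eq.map there p) (Eq.symmetric R (Eq.return (here refl)))

    linked-∷⁻ : ∀ {x y} → Linked ((a , b) ∷ ps) x y → J x y
    linked-∷⁻ = Eq.fold J-isEquivalence J⁺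

    linked-∷⁺ : ∀ {x y} → J x y → Linked ((a , b) ∷ ps) x y
    linked-∷⁺ (inj₁ p)       = Eq.map there p
    linked-∷⁺ (inj₂ (p , q)) = Eq.transitive R (M⇒a p) (Eq.symmetric R (M⇒a q))

  linked-[]⁻ : ∀ {x y} → Linked [] x y → x ≡ y
  linked-[]⁻ = Eq.fold
    (record { refl = refl ; sym = sym ; trans = trans }) λ ()

  linked? : ∀ ps → Decidable (Linked ps)
  linked? []             x y = map′ (λ { refl → ε }) linked-[]⁻ (x ≟ y)
  linked? ((a , b) ∷ ps) x y = map′ linked-∷⁺ linked-∷⁻
    (linked? ps x y ⊎-dec
      ((linked? ps x a ⊎-dec linked? ps x b) ×-dec
       (linked? ps y a ⊎-dec linked? ps y b)))

  SameOrbit : List (A → A) → A → A → Set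
  SameOrbit gs = EqClosure (λ x y → Any (λ g → g x ≡ y) gs)

  sameOrbit? : ∀ gs → Decidable (SameOrbit gs)
  sameOrbit? gs x y = map′ (Eq.map from) (Eq.map to) (linked? graph x y)
    where
    graph : List (A × A)
    graph = cartesianProductWith (λ g z → z , g z) gs elements

    to : ∀ {x y} → Any (λ g → g x ≡ y) gs → (x , y) ∈ graph
    to {x} p with find p
    ... | g , g∈gs , refl = ∈-cartesianProductWith⁺ (λ g z → z , g z) g∈gs (complete x)

    from : ∀ {x y} → (x , y) ∈ graph → Any (λ g → g x ≡ y) gs
    from p with ∈-cartesianProductWith⁻ (λ g z → z , g z) gs elements p
    ... | g , z , g∈gs , _ , refl = Any.map (λ { refl → refl }) g∈gs

  #orbits : List (A → A) → ℕ
  #orbits gs = length (deduplicate (sameOrbit? gs) elements)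

------------------------------------------------------------------------
-- Ribbon graphs
--
-- An edge disc is a rectangle.  Two opposite sides of it are the line
-- segments that it shares with vertex discs (the two ends of the edge); the
-- other two sides are free.  A flag (e , i , s) is the corner of the edge
-- disc e where its end i meets its free side s.

Flag : ℕ → Set
Flag m = Fin m × Bool × Bool

edgeOf : ∀ {m} → Flag m → Fin m
edgeOf = proj₁

across : ∀ {m} → Flag m → Flag m
across (e , i , s) = e , i , not s

along : ∀ {m} → Flag m → Flag m
along (e , i , s) = e , not i , s

-- Up to homeomorphism a ribbon graph is determined by how the corners of its
-- edge discs are joined by the arcs into which the line segments cut the
-- boundary circles of the vertex discs, together with the number of vertex
-- discs that meet no edge.  Conversely, every fixed-point-free involution
-- `arc` arises: traversing line segments (`across`) and arcs alternately
-- closes up into circles, and a vertex disc is glued into each of them.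

record RibbonGraph : Set where
  field
    edges          : ℕ
    isolated       : ℕ
    arc            : Flag edges → Flag edges
    arc-involutive : ∀ x → arc (arc x) ≡ x
    arc-no-fixed   : ∀ x → arc x ≢ x

flags : ∀ m → List (Flag m)
flags m = cartesianProduct (allFin m) (cartesianProduct bools bools)
  where
  bools : List Bool
  bools = false ∷ true ∷ []

flags-complete : ∀ {m} (x : Flag m) → x ∈ flags m
flags-complete (e , i , s) =
  ∈-cartesianProduct⁺ (∈-allFin e) (∈-cartesianProduct⁺ (bool i) (bool s))
  where
  bool : ∀ b → b ∈ false ∷ true ∷ []
  bool false = here refl
  bool true  = there (here refl)

_≟ᶠ_ : ∀ {m} → DecidableEquality (Flag m)
_≟ᶠ_ = Product.≡-dec Fin._≟_ (Product.≡-dec Bool._≟_ Bool._≟_)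

module FlagOrbits (m : ℕ) = Orbits (_≟ᶠ_ {m}) (flags m) flags-complete

module _ (R : RibbonGraph) where
  open RibbonGraph R
  open FlagOrbits edges using (#orbits)

  -- A vertex disc without edges is also a connected component, and its
  -- boundary circle is also a boundary component of the surface.

  v[_] e[_] c[_] f[_] : ℕ
  v[_] = isolated + #orbits (across ∷ arc ∷ [])
  e[_] = edges
  c[_] = isolated + #orbits (across ∷ along ∷ arc ∷ [])
  f[_] = isolated + #orbits (along ∷ arc ∷ [])

  χ : ℤ
  χ = + v[_] ℤ.- + e[_] ℤ.+ + f[_]

  eulerGenus : ℤ
  eulerGenus = + (2 * c[_]) ℤ.- χ

------------------------------------------------------------------------
-- Partial Petrials

-- The half-twist is put in at the end `true` of each edge of A: the two
-- corners at that end are exchanged where they attach to the vertex disc.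

twist : ∀ {m} → Subset m → Flag m → Flag m
twist A (e , false , s) = e , false , s
twist A (e , true  , s) = e , true , Vec.lookup A e xor s

twist-involutive : ∀ {m} (A : Subset m) x → twist A (twist A x) ≡ x
twist-involutive A (e , false , s) = refl
twist-involutive A (e , true  , s) = cong (λ t → e , true , t) (xor² (Vec.lookup A e) s)
  where
  xor² : ∀ a b → a xor (a xor b) ≡ b
  xor² false b = refl
  xor² true  b = Bool.not-involutive b

partialPetrial : (R : RibbonGraph) → Subset (RibbonGraph.edges R) → RibbonGraph
partialPetrial R A = record
  { edges          = edges
  ; isolated       = isolated
  ; arc            = λ x → τ (arc (τ x))
  ; arc-involutive = λ x →
      trans (cong (τ ∘ arc) (τ² (arc (τ x))))
            (trans (cong τ (arc-involutive (τ x))) (τ² x))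
  ; arc-no-fixed   = λ x p → arc-no-fixed (τ x) (trans (sym (τ² (arc (τ x)))) (cong τ p))
  }
  where
  open RibbonGraph R
  τ : Flag edges → Flag edges
  τ = twist A
  τ² : ∀ x → τ (τ x) ≡ x
  τ² = twist-involutive A

------------------------------------------------------------------------
-- Polynomials in z, as coefficient functions
--
-- Exponents are integers only because `eulerGenus` is given by a formula
-- with subtraction.

Polynomial : Set
Polynomial = ℤ → ℕ

infixl 6 _⊕_
infix  7 _·z^_

_·z^_ : ℕ → ℤ → Polynomial
(a ·z^ k) j = if does (j ℤ.≟ k) then a else 0

𝟘 : Polynomial
𝟘 _ = 0

_⊕_ : Polynomial → Polynomial → Polynomial
(P ⊕ Q) j = P j + Q j

Binomial : Polynomial → Set
Binomial P = ∃[ a ] ∃[ k ] ∃[ b ] ∃[ m ]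
  a ≢ 0 × b ≢ 0 × k ≢ m × (∀ j → P j ≡ (a ·z^ k ⊕ b ·z^ m) j)

subsets : ∀ m → List (Subset m)
subsets zero    = Vec.[] ∷ []
subsets (suc m) = map (outside Vec.∷_) (subsets m) ++ map (inside Vec.∷_) (subsets m)

petrialPolynomial : RibbonGraph → Polynomial
petrialPolynomial R =
  foldr _⊕_ 𝟘 (map (λ A → 1 ·z^ eulerGenus (partialPetrial R A)) (subsets (RibbonGraph.edges R)))

------------------------------------------------------------------------
-- Bouquets and circle graphs

record Bouquet : Set where
  field
    ribbonGraph : RibbonGraph
    one-vertex  : v[_] ribbonGraph ≡ 1

  open RibbonGraph ribbonGraph public

  -- One step around the boundary of the vertex: along an arc to the next
  -- line segment, then to the far endpoint of that segment.  The boundary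
  -- carries 2 * edges line segments, so fewer than 2 * edges steps never
  -- return to the starting segment.

  step : Flag edges → Flag edges
  step x = across (arc x)

  at : Flag edges → ℕ → Fin edges
  at x i = edgeOf (iterate step x i)

  Alternating : Fin edges → Fin edges → Set
  Alternating e f = ∃[ x ] ∃[ i ] ∃[ j ] ∃[ k ]
    0 < i × i < j × j < k × k < 2 * edges ×
    at x 0 ≡ e × at x i ≡ f × at x j ≡ e × at x k ≡ f

  Interlaced : Fin edges → Fin edges → Set
  Interlaced e f = e ≢ f × (Alternating e f ⊎ Alternating f e)

intersectionGraph : (B : Bouquet) → SimpleGraph (Bouquet.edges B)
intersectionGraph B = record
  { Adj    = Interlaced
  ; symm   = λ { (e≢f , alt) → e≢f ∘ sym , swap alt }
  ; irrefl = λ { (e≢e , _) → e≢e refl }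
  }
  where open Bouquet B

IsCircleGraph : ∀ {n} → SimpleGraph n → Set
IsCircleGraph G = ∃[ B ] intersectionGraph B ≅ G

-- The polynomial of G is read off from the bouquet that exhibits G as a
-- circle graph; any such bouquet may be supplied.

circleGraphPolynomial : ∀ {n} (G : SimpleGraph n) → IsCircleGraph G → Polynomial
circleGraphPolynomial G (B , _) = petrialPolynomial (Bouquet.ribbonGraph B)

{-# OPTIONS --safe #-}
-- A 0/1 function on the boundary components of a twisted bouquet is the same
-- thing as a function on the arcs of the vertex circle satisfying one linear
-- condition per edge.  Up to a constant it is given by the vector of its jumps
-- across the edges, and the conditions say that this vector lies in the kernel
-- of M + diag A over GF(2), where M is the intersection matrix of the bouquet
-- (with the original twists on the diagonal).  Hence f = 1 + corank and the
-- Euler genus is the rank of M + diag A.  Some A makes the matrix nonsingular,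
-- and toggling an entry of A changes the corank by at most one, so the
-- polynomial is binomial iff no A has corank ≥ 2.
--
-- For a path the first entry of a kernel vector determines the others, so the
-- corank is at most 1.  Conversely (Fiedler's theorem over GF(2)) suppose no A
-- has corank ≥ 2.  Taking Schur complements, this passes to every graph
-- obtained by complementing the neighbourhood of a vertex and deleting that
-- vertex; by induction all of these are paths, and then so is the graph.
module Submission where

open import Defs
open import Data.Bool.Base using (Bool; true; false; not; _∧_; _∨_; _xor_; if_then_else_)
open import Data.Bool.Properties
  using (not-involutive; ¬-not; xor-assoc; xor-comm; xor-same; xor-identityʳ; ∧-comm;
    ∧-zeroʳ; ∧-identityʳ; ∧-distribˡ-xor; ∧-distribʳ-xor; ∨-zeroʳ)
  renaming (_≟_ to _≟ᵇ_)
open import Data.Bool.Solver using (module xor-∧-Solver)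
open import Data.Empty using (⊥; ⊥-elim)
open import Data.Fin.Base using (Fin; zero; suc; toℕ; fromℕ<; combine; remQuot)
open import Data.Fin.Properties
  using (pigeonhole; injective⇒≤; combine-injective; combine-remQuot; 2↔Bool; toℕ<n;
    toℕ-injective; toℕ-fromℕ<)
  renaming (_≟_ to _≟ⁿ_)
open import Data.Fin.Subset using (Subset)
open import Data.Integer.Base as ℤ using (ℤ; +_)
import Data.Integer.Properties as ℤ
open import Data.List.Base
  using (List; []; _∷_; [_]; _++_; length; lookup; map; foldr; tabulate; allFin;
    cartesianProduct; deduplicate)
open import Data.List.Membership.Propositional using (_∈_; find)
open import Data.List.Membership.Propositional.Properties
  using (∈-∃++; ∈-allFin; ∈-tabulate⁺; ∈-cartesianProduct⁺; ∈-lookup; ∈-++⁺ˡ; ∈-++⁺ʳ; ∈-map⁺)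
open import Data.List.Membership.Propositional.Properties.WithK using (unique∧set⇒bag)
open import Data.List.Properties using (length-tabulate)
open import Data.List.Relation.Binary.BagAndSetEquality using (∼bag⇒↭)
open import Data.List.Relation.Binary.Permutation.Propositional as Perm
  using (_↭_; prep; ↭-refl; ↭-sym; ↭-trans; ↭-swap; ↭⇒↭ₛ)
open import Data.List.Relation.Binary.Permutation.Propositional.Properties
  using (∈-resp-↭; ↭-length; ∷↭∷ʳ; shift)
import Data.List.Relation.Binary.Permutation.Setoid.Properties as ↭ₛ
open import Data.List.Relation.Unary.All as All using (All; []; _∷_)
import Data.List.Relation.Unary.All.Properties as All
open import Data.List.Relation.Unary.AllPairs using (AllPairs; []; _∷_)
open import Data.List.Relation.Unary.Any as Any using (Any; here; there; any?)
import Data.List.Relation.Unary.Any.Properties as Any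
open import Data.List.Relation.Unary.Unique.DecSetoid.Properties using (deduplicate-!)
open import Data.List.Relation.Unary.Unique.Propositional using (Unique)
open import Data.List.Relation.Unary.Unique.Propositional.Properties
  using (tabulate⁺; cartesianProduct⁺; allFin⁺)
open import Data.Nat.Base
open import Data.Nat.GeneralisedArithmetic using (iterate)
open import Data.Nat.Properties
open import Data.Product.Base using (∃-syntax; _×_; _,_; proj₁; proj₂; map₂)
open import Data.Sum.Base using (_⊎_; inj₁; inj₂)
import Data.Vec.Base as Vec
open import Data.Vec.Properties using (lookup∘tabulate)
open import Function.Base using (_∘_; id; case_of_)
open import Function.Bundles using (_↔_; _⇔_; mk⇔; mk↔ₛ′; Inverse; Equivalence)
open import Function.Construct.Composition using (_⇔-∘_; _↔-∘_)
open import Function.Construct.Symmetry using (⇔-sym; ↔-sym)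
open import Function.Definitions using (Injective)
open import Relation.Binary.Bundles using (DecSetoid)
import Relation.Binary.Construct.Closure.Equivalence as Eq
import Relation.Binary.Construct.On as On
open import Relation.Binary.Definitions using (DecidableEquality; Symmetric; tri<; tri≈; tri>)
open import Relation.Binary.PropositionalEquality hiding ([_])
open import Relation.Binary.Structures using (IsEquivalence)
open import Relation.Nullary.Decidable
  using (Dec; does; yes; no; does-⇔; decidable-stable; dec-true; dec-false)
open import Relation.Nullary.Negation using (¬_; contradiction)
open import Relation.Unary using (Decidable)
open import Algebra.Properties.AbelianGroup ℤ.+-0-abelianGroup
  using ()
  renaming (∙-cancelˡ to ℤ-cancelˡ)

-- Matrices over GF(2)

-- No rank or dimension is computed. Coranks 0, 1 and at least 2 are told apart by kernel vectors,
-- and one, two and at least three boundary components by functions that separate them; the support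
-- of the polynomial needs no more. As the twists run over all diagonals, only the off-diagonal
-- entries of M carry information: M is read as a graph, and every vertex becomes a pivot by a
-- choice of its diagonal entry. The same freedom gives the two special diagonals. Making all pivots
-- 1 gives corank 0. Taking the row sums gives the Laplacian, whose kernel contains the functions
-- constant on connected components, so corank at least 1 always occurs, and corank at least 2 for
-- every disconnected graph. The obstacle in the induction is that a path found after the pivot v
-- leaves the neighbourhood of v arbitrary; it is restricted by comparing with the local complements
-- at the first two vertices of that path.

infix 10 ⨁

⨁ : {A : Set} → List A → (A → Bool) → Bool
⨁ []      f = false
⨁ (a ∷ l) f = f a xor ⨁ l f

module _ {A : Set} where

  ⨁-cong : ∀ {f g : A → Bool} l → (∀ {a} → a ∈ l → f a ≡ g a) → ⨁ l f ≡ ⨁ l g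
  ⨁-cong []      f≗g = refl
  ⨁-cong (a ∷ l) f≗g = cong₂ _xor_ (f≗g (here refl)) (⨁-cong l (f≗g ∘ there))

  ⨁-xor : ∀ (f g : A → Bool) l → ⨁ l (λ a → f a xor g a) ≡ ⨁ l f xor ⨁ l g
  ⨁-xor f g []      = refl
  ⨁-xor f g (a ∷ l) = trans (cong ((f a xor g a) xor_) (⨁-xor f g l))
    (solve 4 (λ a b c d → (a :+ b) :+ (c :+ d) := (a :+ c) :+ (b :+ d)) refl
       (f a) (g a) (⨁ l f) (⨁ l g))
    where open xor-∧-Solver

  ⨁-∧ˡ : ∀ c (f : A → Bool) l → ⨁ l (λ a → c ∧ f a) ≡ c ∧ ⨁ l f
  ⨁-∧ˡ c f []      = sym (∧-zeroʳ c)
  ⨁-∧ˡ c f (a ∷ l) = trans (cong ((c ∧ f a) xor_) (⨁-∧ˡ c f l))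
    (sym (∧-distribˡ-xor c (f a) (⨁ l f)))

  ⨁-false : ∀ {f : A → Bool} l → (∀ {a} → a ∈ l → f a ≡ false) → ⨁ l f ≡ false
  ⨁-false []      f≗0 = refl
  ⨁-false (a ∷ l) f≗0 = cong₂ _xor_ (f≗0 (here refl)) (⨁-false l (f≗0 ∘ there))

  ⨁-single : ∀ {f : A → Bool} {l q} → Unique l → q ∈ l →
             (∀ {a} → a ∈ l → a ≢ q → f a ≡ false) → ⨁ l f ≡ f q
  ⨁-single {f} {a ∷ l} (a∉l ∷ _) (here refl) f≗0 =
    trans (cong (f a xor_) (⨁-false l λ b∈l →
            f≗0 (there b∈l) (All.lookup a∉l b∈l ∘ sym)))
          (xor-identityʳ (f a))
  ⨁-single {f} {a ∷ l} (a∉l ∷ l!) (there q∈l) f≗0 =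
    cong₂ _xor_ (f≗0 (here refl) (All.lookup a∉l q∈l)) (⨁-single l! q∈l (f≗0 ∘ there))

  ⨁-↭ : ∀ (f : A → Bool) {l m} → l ↭ m → ⨁ l f ≡ ⨁ m f
  ⨁-↭ f Perm.refl         = refl
  ⨁-↭ f (prep a p)        = cong (f a xor_) (⨁-↭ f p)
  ⨁-↭ f (Perm.swap {l} {m} a b p) = trans (cong (λ c → f a xor (f b xor c)) (⨁-↭ f p))
    (solve 3 (λ a b c → a :+ (b :+ c) := b :+ (a :+ c)) refl (f a) (f b) (⨁ m f))
    where open xor-∧-Solver
  ⨁-↭ f (Perm.trans p q)  = trans (⨁-↭ f p) (⨁-↭ f q)

Matrix : Set → Set
Matrix V = V → V → Bool

SymmetricMatrix : {V : Set} → Matrix V → Set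
SymmetricMatrix M = ∀ i j → M i j ≡ M j i

module _ {V : Set} where

  -- Row i of (M + diag D) x, for the principal submatrix on l.
  row : Matrix V → (V → Bool) → List V → (V → Bool) → V → Bool
  row M D l x i = ⨁ l (λ j → M i j ∧ x j) xor (D i ∧ x i)

  Kernel : Matrix V → (V → Bool) → List V → (V → Bool) → Set
  Kernel M D l x = ∀ {i} → i ∈ l → row M D l x i ≡ false

  -- The coordinates `i` and `j`, at which `x` and `y` form an identity matrix, certify
  -- independence; two independent kernel vectors can always be combined into this form. The
  -- diagonal `D` is a field because the condition asks for some choice of twists.
  record Corank≥2 (M : Matrix V) (l : List V) : Set where
    field
      D x y          : V → Bool
      x-kernel       : Kernel M D l x
      y-kernel       : Kernel M D l y
      i j            : V
      i∈l            : i ∈ l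
      j∈l            : j ∈ l
      xᵢ             : x i ≡ true
      yᵢ             : y i ≡ false
      xⱼ             : x j ≡ false
      yⱼ             : y j ≡ true

  Nonsingular : Matrix V → (V → Bool) → List V → Set
  Nonsingular M D l = ∀ x → Kernel M D l x → ∀ {i} → i ∈ l → x i ≡ false

  -- The off-diagonal part is the local complement at v, and (M + diag D)
  -- restricted to v ∷ l has the Schur complement (pivot M v + diag D) on l
  -- when its entry at v is 1.
  pivot : Matrix V → V → Matrix V
  pivot M v i j = M i j xor (M i v ∧ M v j)

  pivot-sym : ∀ {M} v → SymmetricMatrix M → SymmetricMatrix (pivot M v)
  pivot-sym {M} v M-sym i j = cong₂ _xor_ (M-sym i j)
    (trans (cong₂ _∧_ (M-sym i v) (M-sym v j)) (∧-comm (M v i) (M j v)))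

  row-cong : ∀ M {D D′ l x x′ i} → (∀ {j} → j ∈ l → x j ≡ x′ j) →
             i ∈ l → D i ≡ D′ i → row M D l x i ≡ row M D′ l x′ i
  row-cong M {l = l} {i = i} x≗x′ i∈l Dᵢ = cong₂ _xor_
    (⨁-cong l (λ j∈l → cong (M i _ ∧_) (x≗x′ j∈l)))
    (cong₂ _∧_ Dᵢ (x≗x′ i∈l))

  -- Elimination of the unknown `x v`. The hypothesis is row `v` of the kernel equation when the
  -- pivot is 1, so kernel vectors can be moved in both directions.
  row-pivot : ∀ M D {v l x} i → x v ≡ ⨁ l (λ j → M v j ∧ x j) →
              row M D (v ∷ l) x i ≡ row (pivot M v) D l x i
  row-pivot M D {v} {l} {x} i xᵥ = cong (_xor (D i ∧ x i)) (begin
    (M i v ∧ x v) xor S                                       ≡⟨ cong (λ b → (M i v ∧ b) xor S) xᵥ ⟩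
    (M i v ∧ ⨁ l (λ j → M v j ∧ x j)) xor S                   ≡⟨ xor-comm _ S ⟩
    S xor (M i v ∧ ⨁ l (λ j → M v j ∧ x j))                   ≡⟨ cong (S xor_) (⨁-∧ˡ (M i v) _ l) ⟨
    S xor ⨁ l (λ j → M i v ∧ (M v j ∧ x j))                   ≡⟨ ⨁-xor _ _ l ⟨
    ⨁ l (λ j → (M i j ∧ x j) xor (M i v ∧ (M v j ∧ x j)))     ≡⟨ ⨁-cong l (λ {j} _ → lemma (M i j) (M i v) (M v j) (x j)) ⟩
    ⨁ l (λ j → pivot M v i j ∧ x j)                           ∎)
    where
    open ≡-Reasoning
    S = ⨁ l (λ j → M i j ∧ x j)
    open xor-∧-Solver
    lemma : ∀ a b c d → (a ∧ d) xor (b ∧ (c ∧ d)) ≡ (a xor (b ∧ c)) ∧ d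
    lemma = solve 4 (λ a b c d → (a :* d) :+ (b :* (c :* d)) := (a :+ (b :* c)) :* d) refl

  -- The pivot entry of M + diag D is 1, so row v of a kernel vector determines x v.
  row-at-pivot : ∀ M D {v} l {x} → D v ≡ not (M v v) →
                 row M D (v ∷ l) x v ≡ x v xor ⨁ l (λ j → M v j ∧ x j)
  row-at-pivot M D {v} l {x} Dᵥ =
    trans (cong (λ d → ((M v v ∧ x v) xor S) xor (d ∧ x v)) Dᵥ) (lemma (M v v) (x v) S)
    where
    S = ⨁ l (λ j → M v j ∧ x j)
    lemma : ∀ m a s → ((m ∧ a) xor s) xor (not m ∧ a) ≡ a xor s
    lemma true  true  true  = refl
    lemma true  true  false = refl
    lemma true  false true  = refl
    lemma true  false false = refl
    lemma false true  true  = refl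
    lemma false true  false = refl
    lemma false false true  = refl
    lemma false false false = refl

xor-≡ : ∀ {a b} → a xor b ≡ false → a ≡ b
xor-≡ {true}  {true}  _ = refl
xor-≡ {false} {false} _ = refl

module _ {V : Set} (_≟_ : DecidableEquality V) where

  _[_≔_] : (V → Bool) → V → Bool → V → Bool
  (f [ v ≔ b ]) j = if does (j ≟ v) then b else f j

  ≔-same : ∀ f v b → (f [ v ≔ b ]) v ≡ b
  ≔-same f v b with v ≟ v
  ... | yes _  = refl
  ... | no v≢v = contradiction refl v≢v

  ≔-other : ∀ f b {v j} → v ≢ j → (f [ v ≔ b ]) j ≡ f j
  ≔-other f b {v} {j} v≢j with j ≟ v
  ... | yes j≡v = contradiction (sym j≡v) v≢j
  ... | no _    = refl

  -- The new diagonal entry makes the pivot equal to 1, and the new coordinate is then the only one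
  -- that solves row `v`; the other rows become those of the Schur complement.
  kernel-unpivot : ∀ {M D v l x} → All (v ≢_) l → Kernel (pivot M v) D l x →
    Kernel M (D [ v ≔ not (M v v) ]) (v ∷ l) (x [ v ≔ ⨁ l (λ j → M v j ∧ x j) ])
  kernel-unpivot {M} {D} {v} {l} {x} v∉l ker = λ where
      (here refl) → trans (row-at-pivot M D⁺ l (≔-same D v _))
        (trans (cong (_xor S⁺) x⁺ᵥ) (xor-same S⁺))
      (there i∈l) → trans (row-pivot M D⁺ {l = l} _ x⁺ᵥ)
        (trans (row-cong (pivot M v) {D⁺} {D} {l} {x⁺} {x} x⁺ⱼ i∈l (≔-other D _ (All.lookup v∉l i∈l))) (ker i∈l))
    where
    S  = ⨁ l (λ j → M v j ∧ x j)
    D⁺ = D [ v ≔ not (M v v) ]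
    x⁺ = x [ v ≔ S ]
    S⁺ = ⨁ l (λ j → M v j ∧ x⁺ j)
    x⁺ⱼ : ∀ {j} → j ∈ l → x⁺ j ≡ x j
    x⁺ⱼ j∈l = ≔-other x _ (All.lookup v∉l j∈l)
    x⁺ᵥ : x⁺ v ≡ S⁺
    x⁺ᵥ = trans (≔-same x v S) (⨁-cong l (λ j∈l → cong (M v _ ∧_) (sym (x⁺ⱼ j∈l))))

  corank≥2-unpivot : ∀ {M v l} → All (v ≢_) l → Corank≥2 (pivot M v) l → Corank≥2 M (v ∷ l)
  corank≥2-unpivot {M} v∉l c = record
    { x-kernel = kernel-unpivot {M} {D} {x = x} v∉l x-kernel
    ; y-kernel = kernel-unpivot {M} {D} {x = y} v∉l y-kernel
    ; i∈l = there i∈l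
    ; j∈l = there j∈l
    ; xᵢ = trans (≔-other x _ (All.lookup v∉l i∈l)) xᵢ
    ; yᵢ = trans (≔-other y _ (All.lookup v∉l i∈l)) yᵢ
    ; xⱼ = trans (≔-other x _ (All.lookup v∉l j∈l)) xⱼ
    ; yⱼ = trans (≔-other y _ (All.lookup v∉l j∈l)) yⱼ
    }
    where open Corank≥2 c

  -- A diagonal entry enters the Schur complement at its own place only, so the pivots can be made 1
  -- in turn. Back substitution then forces kernel vectors to vanish.
  ∃-nonsingular : ∀ M {l} → Unique l → ∃[ D ] Nonsingular M D l
  ∃-nonsingular M {[]}    []         = (λ _ → false) , λ _ _ ()
  ∃-nonsingular M {v ∷ l} (v∉l ∷ l!) = D⁺ , λ x ker →
      let xᵥ  = xor-≡ (trans (sym (row-at-pivot M D⁺ l {x} (≔-same D v _))) (ker (here refl)))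
          x≗0 = nonsing x λ {i} i∈l →
                  trans (row-cong (pivot M v) {D} {D⁺} {l} {x} (λ _ → refl) i∈l
                           (sym (≔-other D _ (All.lookup v∉l i∈l))))
                        (trans (sym (row-pivot M D⁺ {l = l} i xᵥ)) (ker (there i∈l)))
      in λ where
        (here refl) → trans xᵥ (⨁-false l λ j∈l →
          trans (cong (M v _ ∧_) (x≗0 j∈l)) (∧-zeroʳ _))
        (there i∈l) → x≗0 i∈l
    where
    IH = ∃-nonsingular (pivot M v) l!
    D = proj₁ IH
    nonsing = proj₂ IH
    D⁺ = D [ v ≔ not (M v v) ]

module _ {V : Set} where

  corank≥2-resp-↭ : ∀ {M : Matrix V} {l m} → l ↭ m → Corank≥2 M l → Corank≥2 M m
  corank≥2-resp-↭ {M} {l} {m} l↭m c = record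
    { x-kernel = kernel x-kernel
    ; y-kernel = kernel y-kernel
    ; i∈l = ∈-resp-↭ l↭m i∈l
    ; j∈l = ∈-resp-↭ l↭m j∈l
    ; xᵢ = xᵢ ; yᵢ = yᵢ ; xⱼ = xⱼ ; yⱼ = yⱼ
    }
    where
    open Corank≥2 c
    kernel : ∀ {x} → Kernel M D l x → Kernel M D m x
    kernel {x} ker {i} i∈m = trans (cong (_xor (D i ∧ x i)) (⨁-↭ _ (↭-sym l↭m)))
                                   (ker (∈-resp-↭ (↭-sym l↭m) i∈m))

  LocallyConstant : Matrix V → List V → (V → Bool) → Set
  LocallyConstant M l x = ∀ {i j} → i ∈ l → j ∈ l → M i j ≡ true → x i ≡ x j

  -- With its row sums on the diagonal, `M` becomes a Laplacian over GF(2), which annihilates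
  -- functions constant along edges. The entry `M i i` occurs both in the row and in the row sum and
  -- cancels.
  kernel-locallyConstant : ∀ {M l x} → LocallyConstant M l x → Kernel M (λ i → ⨁ l (M i)) l x
  kernel-locallyConstant {M} {l} {x} const {i} i∈l = begin
    ⨁ l (λ j → M i j ∧ x j) xor (D ∧ x i)  ≡⟨ cong (_xor (D ∧ x i)) (⨁-cong l (λ {j} j∈l → entry j∈l (M i _) refl)) ⟩
    ⨁ l (λ j → x i ∧ M i j) xor (D ∧ x i)  ≡⟨ cong (_xor (D ∧ x i)) (⨁-∧ˡ (x i) (M i) l) ⟩
    (x i ∧ D) xor (D ∧ x i)                ≡⟨ cong (_xor (D ∧ x i)) (∧-comm (x i) D) ⟩
    (D ∧ x i) xor (D ∧ x i)                ≡⟨ xor-same (D ∧ x i) ⟩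
    false                                  ∎
    where
    open ≡-Reasoning
    D = ⨁ l (M i)
    entry : ∀ {j} → j ∈ l → ∀ b → M i j ≡ b → b ∧ x j ≡ x i ∧ b
    entry j∈l true  Mᵢⱼ = trans (sym (const i∈l j∈l Mᵢⱼ)) (sym (∧-identityʳ (x i)))
    entry j∈l false Mᵢⱼ = sym (∧-zeroʳ (x i))

  -- For a disconnected graph: the indicator of a union of components and its complement are
  -- independent in the kernel of the Laplacian.
  corank≥2-split : ∀ {M l} (x : V → Bool) → LocallyConstant M l x →
                   ∀ {i j} → i ∈ l → j ∈ l → x i ≡ true → x j ≡ false → Corank≥2 M l
  corank≥2-split x const i∈l j∈l xᵢ xⱼ = record
    { x-kernel = kernel-locallyConstant const
    ; y-kernel = kernel-locallyConstant λ i∈l j∈l Mᵢⱼ → cong not (const i∈l j∈l Mᵢⱼ)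
    ; i∈l = i∈l
    ; j∈l = j∈l
    ; xᵢ = xᵢ
    ; yᵢ = cong not xᵢ
    ; xⱼ = xⱼ
    ; yⱼ = cong not xⱼ
    }

-- Graphs with adjacency matrix of corank at most one

unique-resp-↭ : {V : Set} {l m : List V} → l ↭ m → Unique l → Unique m
unique-resp-↭ {V} p = ↭ₛ.Unique-resp-↭ (setoid V) (↭⇒↭ₛ p)

-- For symmetric `M`, an induced path listed from one of its ends. The diagonal of `M` is
-- unconstrained, since the choice of `D` absorbs it.
data Line {V : Set} (M : Matrix V) : List V → Set where
  single : ∀ u → Line M [ u ]
  link   : ∀ {u v l} → M u v ≡ true → All (λ w → M u w ≡ false) l →
           Line M (v ∷ l) → Line M (u ∷ v ∷ l)

Linear : {V : Set} → Matrix V → List V → Set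
Linear M l = ∃[ q ] q ↭ l × Line M q

module _ {V : Set} where

  linear-resp-↭ : ∀ {M : Matrix V} {l m} → l ↭ m → Linear M l → Linear M m
  linear-resp-↭ l↭m (q , q↭l , line) = q , ↭-trans q↭l l↭m , line

  line-cong : ∀ {M N : Matrix V} {l} → Unique l →
              (∀ {i j} → i ∈ l → j ∈ l → i ≢ j → M i j ≡ N i j) → Line M l → Line N l
  line-cong _ M≗N (single u) = single u
  line-cong ((u≢v ∷ u∉l) ∷ l!) M≗N (link Muv Mul line) = link
    (trans (sym (M≗N (here refl) (there (here refl)) u≢v)) Muv)
    (All.tabulate λ w∈l → trans
      (sym (M≗N (here refl) (there (there w∈l)) (All.lookup u∉l w∈l)))
      (All.lookup Mul w∈l))
    (line-cong l! (λ i∈ j∈ → M≗N (there i∈) (there j∈)) line)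

  line-next : ∀ {M : Matrix V} {u v l w} → Line M (u ∷ v ∷ l) → w ∈ v ∷ l →
              M u w ≡ true → w ≡ v
  line-next _              (here w≡v)  _   = w≡v
  line-next (link _ Mul _) (there w∈l) Muw
    with () ← trans (sym Muw) (All.lookup Mul w∈l)

  -- The vertex of the triangle that comes first in the list would have two later neighbours, and
  -- `line-next` allows only one.
  line-triangle-free : ∀ {M : Matrix V} → SymmetricMatrix M → ∀ {l a b c} → Line M l →
    a ∈ l → b ∈ l → c ∈ l → a ≢ b → b ≢ c → a ≢ c →
    M a b ≡ true → M b c ≡ true → M a c ≡ true → ⊥
  line-triangle-free M-sym = go
    where
    go : ∀ {l a b c} → Line _ l → a ∈ l → b ∈ l → c ∈ l → a ≢ b → b ≢ c → a ≢ c →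
         _ ≡ true → _ ≡ true → _ ≡ true → ⊥
    go _ (here refl) (here refl) _ a≢b _ _ _ _ _ = a≢b refl
    go _ (here refl) _ (here refl) _ _ a≢c _ _ _ = a≢c refl
    go _ _ (here refl) (here refl) _ b≢c _ _ _ _ = b≢c refl
    go line@(link _ _ _) (here refl) (there b∈) (there c∈) _ b≢c _ ab bc ac =
      b≢c (trans (line-next line b∈ ab) (sym (line-next line c∈ ac)))
    go line@(link _ _ _) (there a∈) (here refl) (there c∈) _ _ a≢c ab bc ac =
      a≢c (trans (line-next line a∈ (trans (M-sym _ _) ab)) (sym (line-next line c∈ bc)))
    go line@(link _ _ _) (there a∈) (there b∈) (here refl) a≢b _ _ ab bc ac =
      a≢b (trans (line-next line a∈ (trans (M-sym _ _) ac))
                 (sym (line-next line b∈ (trans (M-sym _ _) bc))))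
    go (link _ _ line) (there a∈) (there b∈) (there c∈) = go line a∈ b∈ c∈

  -- A bound on the degree: nothing is asked about edges among `a`, `b` and `c`. If `u` is the first
  -- of the four in the list, it has more than one later neighbour. Otherwise `u` directly follows
  -- the first of them and has two later neighbours itself, which `second` excludes.
  line-claw-free : ∀ {M : Matrix V} → SymmetricMatrix M → ∀ {l u a b c} → Line M l →
    u ∈ l → a ∈ l → b ∈ l → c ∈ l → u ≢ a → u ≢ b → u ≢ c → a ≢ b → b ≢ c → a ≢ c →
    M u a ≡ true → M u b ≡ true → M u c ≡ true → ⊥
  line-claw-free {M} M-sym = go
    where
    second : ∀ {u v l b c} → Line M (u ∷ v ∷ l) → b ∈ v ∷ l → c ∈ v ∷ l → v ≢ b → v ≢ c → b ≢ c →
           M v b ≡ true → M v c ≡ true → ⊥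
    second _ (here refl) _ v≢b _ _ _ _ = v≢b refl
    second _ _ (here refl) _ v≢c _ _ _ = v≢c refl
    second (link _ _ line@(link _ _ _)) (there b∈) (there c∈) _ _ b≢c vb vc =
      b≢c (trans (line-next line b∈ vb) (sym (line-next line c∈ vc)))

    go : ∀ {l u a b c} → Line M l → u ∈ l → a ∈ l → b ∈ l → c ∈ l →
         u ≢ a → u ≢ b → u ≢ c → a ≢ b → b ≢ c → a ≢ c →
         M u a ≡ true → M u b ≡ true → M u c ≡ true → ⊥
    go _ (here refl) (here refl) _ _ u≢a _ _ _ _ _ _ _ _ = u≢a refl
    go _ (here refl) _ (here refl) _ _ u≢b _ _ _ _ _ _ _ = u≢b refl
    go line@(link _ _ _) (here refl) (there a∈) (there b∈) _ _ _ _ a≢b _ _ ua ub _ =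
      a≢b (trans (line-next line a∈ ua) (sym (line-next line b∈ ub)))
    go _ _ (here refl) (here refl) _ _ _ _ a≢b _ _ _ _ _ = a≢b refl
    go _ _ (here refl) _ (here refl) _ _ _ _ _ a≢c _ _ _ = a≢c refl
    go _ _ _ (here refl) (here refl) _ _ _ _ b≢c _ _ _ _ = b≢c refl
    go line@(link _ _ _) (there u∈) (here refl) (there b∈) (there c∈) _ u≢b u≢c _ b≢c _ ua ub uc
      with refl ← line-next line u∈ (trans (M-sym _ _) ua) = second line b∈ c∈ u≢b u≢c b≢c ub uc
    go line@(link _ _ _) (there u∈) (there a∈) (here refl) (there c∈) u≢a _ u≢c _ _ a≢c ua ub uc
      with refl ← line-next line u∈ (trans (M-sym _ _) ub) = second line a∈ c∈ u≢a u≢c a≢c ua uc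
    go line@(link _ _ _) (there u∈) (there a∈) (there b∈) (here refl) u≢a u≢b _ a≢b _ _ ua ub uc
      with refl ← line-next line u∈ (trans (M-sym _ _) uc) = second line a∈ b∈ u≢a u≢b a≢b ua ub
    go (link _ _ line) (there u∈) (there a∈) (there b∈) (there c∈) = go line u∈ a∈ b∈ c∈

  record Inner (M : Matrix V) (l : List V) (w : V) : Set where
    field
      {p s}       : V
      p∈l         : p ∈ l
      s∈l         : s ∈ l
      p≢w         : p ≢ w
      s≢w         : s ≢ w
      p≢s         : p ≢ s
      wp          : M w p ≡ true
      ws          : M w s ≡ true
      ps          : M p s ≡ false

  -- As `w` is not the first vertex, it has a predecessor. Either it is the last vertex, and `u`
  -- prolongs the path beyond it, or it also has a successor.
  line-extendʳ : ∀ {M : Matrix V} → SymmetricMatrix M → ∀ {x l u w} → Line M (x ∷ l) →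
    Unique (x ∷ l) → w ∈ l → M w u ≡ true → (∀ {j} → j ∈ x ∷ l → j ≢ w → M j u ≡ false) →
    Line M (x ∷ l ++ [ u ]) ⊎ Inner M (x ∷ l) w
  line-extendʳ M-sym (link xy _ (single y)) ((x≢y ∷ _) ∷ _) (here refl) wu ju =
    inj₁ (link xy (ju (here refl) x≢y ∷ []) (link wu [] (single _)))
  line-extendʳ M-sym (link xy (xz ∷ _) (link yz _ _)) ((x≢y ∷ x≢z ∷ _) ∷ ((y≢z ∷ _) ∷ _)) (here refl) wu ju =
    inj₂ record
      { p∈l = here refl ; s∈l = there (there (here refl))
      ; p≢w = x≢y ; s≢w = y≢z ∘ sym ; p≢s = x≢z
      ; wp = trans (M-sym _ _) xy ; ws = yz ; ps = xz }
  line-extendʳ M-sym (link xy xl line) ((x≢y ∷ x∉l) ∷ l!) (there w∈l) wu ju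
    with line-extendʳ M-sym line l! w∈l wu (ju ∘ there)
  ... | inj₁ line′ = inj₁ (link xy (All.++⁺ xl (ju (here refl) (All.lookup x∉l w∈l) ∷ [])) line′)
  ... | inj₂ inner = inj₂ record { Inner inner ; p∈l = there (Inner.p∈l inner) ; s∈l = there (Inner.s∈l inner) }

  pivot-entry : ∀ (M : Matrix V) {u i j a b c} → M i j ≡ a → M i u ≡ b → M u j ≡ c →
                pivot M u i j ≡ a xor (b ∧ c)
  pivot-entry M p q r = cong₂ _xor_ p (cong₂ _∧_ q r)

  unpivot-entry : ∀ (M : Matrix V) {u i j a b c} → pivot M u i j ≡ a → M i u ≡ b → M u j ≡ c →
                  M i j ≡ a xor (b ∧ c)
  unpivot-entry M {u} {i} {j} p q r =
    trans (lemma (M i j) (M i u ∧ M u j)) (cong₂ _xor_ p (cong₂ _∧_ q r))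
    where
    lemma : ∀ a b → a ≡ (a xor b) xor b
    lemma true  true  = refl
    lemma true  false = refl
    lemma false true  = refl
    lemma false false = refl

  line-extend : ∀ {M : Matrix V} → SymmetricMatrix M → ∀ {l u w} → Line M l → Unique l →
    w ∈ l → M u w ≡ true → (∀ {j} → j ∈ l → j ≢ w → M u j ≡ false) →
    Linear M (u ∷ l) ⊎ Inner M l w
  line-extend M-sym line (x∉l ∷ _) (here refl) uw uj = inj₁
    (_ , ↭-refl , link uw (All.tabulate λ j∈l → uj (there j∈l) (All.lookup x∉l j∈l ∘ sym)) line)
  line-extend M-sym line l! (there w∈l) uw uj
    with line-extendʳ M-sym line l! w∈l (trans (M-sym _ _) uw)
           (λ j∈l j≢w → trans (M-sym _ _) (uj j∈l j≢w))
  ... | inj₁ line′ = inj₁ (_ , ↭-sym (∷↭∷ʳ _ _) , line′)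
  ... | inj₂ inner = inj₂ inner

Dichotomy : {V : Set} → Matrix V → List V → Set
Dichotomy M l = Corank≥2 M l ⊎ Linear M l

dichotomy-resp-↭ : ∀ {V} {M : Matrix V} {l m} → l ↭ m → Dichotomy M l → Dichotomy M m
dichotomy-resp-↭ l↭m (inj₁ c) = inj₁ (corank≥2-resp-↭ l↭m c)
dichotomy-resp-↭ l↭m (inj₂ q) = inj₂ (linear-resp-↭ l↭m q)

-- Induction by local complementation

module _ {V : Set} (_≟_ : DecidableEquality V) where

  module Step {k : ℕ}
    (IH : ∀ {M} → SymmetricMatrix M → ∀ {l : List V} → Unique l → length l ≡ suc k → Dichotomy M l)
    {M : Matrix V} (M-sym : SymmetricMatrix M)
    {l : List V} (l! : Unique l) (∣l∣ : length l ≡ suc (suc k)) where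

    -- The induction hypothesis covers all matrices of the smaller size, so any vertex may serve as
    -- the pivot, and a shape that is impossible in a path but shows up after some pivot proves
    -- `Corank≥2 M l`.
    pivot-dichotomy : ∀ {u r} → u ∷ r ↭ l → Corank≥2 M l ⊎ Linear (pivot M u) r
    pivot-dichotomy ur↭l
      with unique-resp-↭ (↭-sym ur↭l) l!
    ... | u∉r ∷ r! with IH (pivot-sym _ M-sym) r! (suc-injective (trans (↭-length ur↭l) ∣l∣))
    ... | inj₁ c = inj₁ (corank≥2-resp-↭ ur↭l (corank≥2-unpivot _≟_ u∉r c))
    ... | inj₂ q = inj₂ q

    triangle : ∀ {u r} → u ∷ r ↭ l →
      ∀ {a b c} → a ∈ r → b ∈ r → c ∈ r → a ≢ b → b ≢ c → a ≢ c →
      pivot M u a b ≡ true → pivot M u b c ≡ true → pivot M u a c ≡ true → Corank≥2 M l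
    triangle ur↭l a∈ b∈ c∈ a≢b b≢c a≢c ab bc ac with pivot-dichotomy ur↭l
    ... | inj₁ c = c
    ... | inj₂ (q , q↭r , line) = ⊥-elim (line-triangle-free (pivot-sym _ M-sym) line
            (∈q a∈) (∈q b∈) (∈q c∈) a≢b b≢c a≢c ab bc ac)
      where
      ∈q : ∀ {j} → j ∈ _ → j ∈ q
      ∈q = ∈-resp-↭ (↭-sym q↭r)

    claw : ∀ {u r} → u ∷ r ↭ l →
      ∀ {v a b c} → v ∈ r → a ∈ r → b ∈ r → c ∈ r →
      v ≢ a → v ≢ b → v ≢ c → a ≢ b → b ≢ c → a ≢ c →
      pivot M u v a ≡ true → pivot M u v b ≡ true → pivot M u v c ≡ true → Corank≥2 M l
    claw ur↭l v∈ a∈ b∈ c∈ v≢a v≢b v≢c a≢b b≢c a≢c va vb vc with pivot-dichotomy ur↭l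
    ... | inj₁ c = c
    ... | inj₂ (q , q↭r , line) = ⊥-elim (line-claw-free (pivot-sym _ M-sym) line
            (∈q v∈) (∈q a∈) (∈q b∈) (∈q c∈) v≢a v≢b v≢c a≢b b≢c a≢c va vb vc)
      where
      ∈q : ∀ {j} → j ∈ _ → j ∈ q
      ∈q = ∈-resp-↭ (↭-sym q↭r)

    -- A leaf attached to an inner vertex w of a path forms a triangle with the
    -- two path neighbours of w in the local complement at w.
    leaf : ∀ {u r w} → u ∷ r ↭ l → w ∈ r → M u w ≡ true →
           (∀ {j} → j ∈ r → j ≢ w → M u j ≡ false) → Dichotomy M l
    leaf {u} {r} {w} ur↭l w∈r uw uj with pivot-dichotomy ur↭l
    ... | inj₁ c = inj₁ c
    ... | inj₂ (q , q↭r , line) with unique-resp-↭ (↭-sym ur↭l) l!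
    ... | u∉r ∷ r! with line-extend M-sym line′ q! (∈-resp-↭ (↭-sym q↭r) w∈r) uw
                          (uj ∘ ∈-resp-↭ q↭r)
      where
      q! : Unique q
      q! = unique-resp-↭ (↭-sym q↭r) r!

      -- The neighbourhood of the leaf `u` is `w` alone and contains no pair to complement.
      unchanged : ∀ {i j} → i ∈ q → j ∈ q → i ≢ j → pivot M u i j ≡ M i j
      unchanged {i} {j} i∈q j∈q i≢j = trans (cong (M i j xor_) vanish) (xor-identityʳ (M i j))
        where
        vanish : M i u ∧ M u j ≡ false
        vanish with i ≟ w
        ... | no i≢w = cong (_∧ M u j) (trans (M-sym i u) (uj (∈-resp-↭ q↭r i∈q) i≢w))
        ... | yes refl = trans (cong (M i u ∧_) (uj (∈-resp-↭ q↭r j∈q) (i≢j ∘ sym)))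
                               (∧-zeroʳ (M i u))

      line′ : Line M q
      line′ = line-cong q! unchanged line
    ... | inj₁ linear = inj₂ (linear-resp-↭ (↭-trans (prep u q↭r) ur↭l) linear)
    ... | inj₂ inner with ∈-∃++ w∈r
    ... | r₁ , r₂ , refl = inj₁ (triangle wur↭l (here refl) (∈rest p∈l p≢w) (∈rest s∈l s≢w)
            (All.lookup u∉r (∈-resp-↭ q↭r p∈l)) p≢s (All.lookup u∉r (∈-resp-↭ q↭r s∈l))
            (pivot-entry M (uj (∈-resp-↭ q↭r p∈l) p≢w) uw wp)
            (pivot-entry M ps (trans (M-sym _ _) wp) ws)
            (pivot-entry M (uj (∈-resp-↭ q↭r s∈l) s≢w) uw ws))
      where
      open Inner inner
      wur↭l : w ∷ u ∷ r₁ ++ r₂ ↭ l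
      wur↭l = ↭-trans (↭-swap w u ↭-refl) (↭-trans (prep u (↭-sym (shift w r₁ r₂))) ur↭l)
      ∈rest : ∀ {j} → j ∈ q → j ≢ w → j ∈ u ∷ r₁ ++ r₂
      ∈rest j∈q j≢w with ∈-resp-↭ (↭-trans q↭r (shift w r₁ r₂)) j∈q
      ... | here j≡w = contradiction j≡w j≢w
      ... | there j∈ = there j∈

  -- M is the path q with the neighbourhood of v complemented.  Unless v or q₁
  -- is a leaf, pivoting at q₁ or q₂ instead produces a claw, a triangle or a
  -- disconnected graph.
  pivoted-line⇒dichotomy : ∀ {k}
    (IH : ∀ {M} → SymmetricMatrix M → ∀ {l : List V} → Unique l → length l ≡ suc k → Dichotomy M l)
    {M : Matrix V} → SymmetricMatrix M → ∀ {v q} → Line (pivot M v) q → Unique (v ∷ q) →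
    length q ≡ suc k → Dichotomy M (v ∷ q)
  pivoted-line⇒dichotomy {k} IH {M} M-sym {v} = go
    where
    -- Undoing the complementation expresses `M` by the adjacencies of `v`: from `q₃` on, `q₁` has
    -- the same neighbours as `v`. The values `s₂` and `s₃` then select a pivot after which a path
    -- is impossible.
    far : ∀ {q₁ q₂ q₃ qs s₂ s₃} → Line (pivot M v) (q₁ ∷ q₂ ∷ q₃ ∷ qs) →
          Unique (v ∷ q₁ ∷ q₂ ∷ q₃ ∷ qs) → length (q₁ ∷ q₂ ∷ q₃ ∷ qs) ≡ suc k →
          M v q₁ ≡ true → M v q₂ ≡ s₂ → M v q₃ ≡ s₃ →
          Any (λ z → M v z ≡ true) (q₃ ∷ qs) → Corank≥2 M (v ∷ q₁ ∷ q₂ ∷ q₃ ∷ qs)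
    far {q₁} {q₂} {q₃} {qs} {s₂} {s₃} (link t₁₂ (t₁₃ ∷ t₁) (link t₂₃ t₂ _))
        l!@((v≢q₁ ∷ v≢q₂ ∷ v≢q₃ ∷ v∉qs) ∷ (q₁≢q₂ ∷ q₁≢q₃ ∷ q₁∉qs) ∷ (q₂≢q₃ ∷ q₂∉qs) ∷ (q₃∉qs ∷ _))
        ∣q∣ e₁ e₂ e₃ some = cases s₂ s₃ e₂ e₃ some (any? (λ z → M v z ≟ᵇ true) qs)
      where
      l : List V
      l = v ∷ q₁ ∷ q₂ ∷ q₃ ∷ qs

      open Step IH M-sym l! (cong suc ∣q∣)

      sym-entry : ∀ {i j b} → M i j ≡ b → M j i ≡ b
      sym-entry = trans (M-sym _ _)

      m₁₂ : ∀ {b} → M v q₂ ≡ b → M q₁ q₂ ≡ true xor b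
      m₁₂ e = unpivot-entry M t₁₂ (sym-entry e₁) e
      m₁₃ : ∀ {b} → M v q₃ ≡ b → M q₁ q₃ ≡ b
      m₁₃ e = unpivot-entry M t₁₃ (sym-entry e₁) e
      m₁ : ∀ {b z} → z ∈ qs → M v z ≡ b → M q₁ z ≡ b
      m₁ z∈ e = unpivot-entry M (All.lookup t₁ z∈) (sym-entry e₁) e
      m₂₃ : ∀ {b c} → M v q₂ ≡ b → M v q₃ ≡ c → M q₂ q₃ ≡ true xor (b ∧ c)
      m₂₃ e e′ = unpivot-entry M t₂₃ (sym-entry e) e′
      m₂ : ∀ {b c z} → z ∈ qs → M v q₂ ≡ b → M v z ≡ c → M q₂ z ≡ b ∧ c
      m₂ z∈ e e′ = unpivot-entry M (All.lookup t₂ z∈) (sym-entry e) e′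

      p₁ : q₁ ∷ v ∷ q₂ ∷ q₃ ∷ qs ↭ l
      p₁ = ↭-swap q₁ v ↭-refl
      p₂ : q₂ ∷ v ∷ q₁ ∷ q₃ ∷ qs ↭ l
      p₂ = ↭-trans (↭-swap q₂ v ↭-refl) (prep v (↭-swap q₂ q₁ ↭-refl))

      cases : ∀ s₂ s₃ → M v q₂ ≡ s₂ → M v q₃ ≡ s₃ → Any (λ z → M v z ≡ true) (q₃ ∷ qs) →
              Dec (Any (λ z → M v z ≡ true) qs) → Corank≥2 M l
      cases _ false e₂ e₃ (here e) _ with () ← trans (sym e) e₃
      -- After the pivot `q₁`, the vertex `q₂` has the three neighbours `v`, `q₃` and `z`, whatever
      -- `s₂` is.
      cases s₂ false e₂ e₃ (there some) _ with find some
      ... | z , z∈ , e = claw p₁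
              (there (here refl)) (here refl) (there (there (here refl))) (there (there (there z∈)))
              (v≢q₂ ∘ sym) q₂≢q₃ (All.lookup q₂∉qs z∈)
              v≢q₃ (All.lookup q₃∉qs z∈) (All.lookup v∉qs z∈)
              (trans (pivot-entry M (sym-entry e₂) (sym-entry (m₁₂ e₂)) (sym-entry e₁)) (entry s₂))
              (trans (pivot-entry M (m₂₃ e₂ e₃) (sym-entry (m₁₂ e₂)) (m₁₃ e₃)) (entry′ s₂))
              (trans (pivot-entry M (m₂ z∈ e₂ e) (sym-entry (m₁₂ e₂)) (m₁ z∈ e)) (entry″ s₂))
        where
        entry : ∀ s → s xor ((true xor s) ∧ true) ≡ true
        entry true  = refl
        entry false = refl
        entry′ : ∀ s → (true xor (s ∧ false)) xor ((true xor s) ∧ false) ≡ true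
        entry′ true  = refl
        entry′ false = refl
        entry″ : ∀ s → (s ∧ true) xor ((true xor s) ∧ true) ≡ true
        entry″ true  = refl
        entry″ false = refl
      -- In `M` the vertices `v`, `q₁`, `q₃` form a triangle of which `q₂` sees only `v`, so the
      -- pivot `q₂` leaves it intact.
      cases true true e₂ e₃ _ _ = triangle p₂
        (here refl) (there (here refl)) (there (there (here refl))) v≢q₁ q₁≢q₃ v≢q₃
        (pivot-entry M e₁ e₂ (sym-entry (m₁₂ e₂)))
        (pivot-entry M (m₁₃ e₃) (m₁₂ e₂) refl)
        (pivot-entry M e₃ e₂ (m₂₃ e₂ e₃))
      -- Since `q₂` is not adjacent to `v`, the pivot `q₂` preserves the edges from `v` to `q₁`,
      -- `q₃` and `z`.
      cases false true e₂ e₃ _ (yes some) with find some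
      ... | z , z∈ , e = claw p₂
              (here refl) (there (here refl)) (there (there (here refl))) (there (there (there z∈)))
              v≢q₁ v≢q₃ (All.lookup v∉qs z∈)
              q₁≢q₃ (All.lookup q₃∉qs z∈) (All.lookup q₁∉qs z∈)
              (pivot-entry M e₁ e₂ refl) (pivot-entry M e₃ e₂ refl) (pivot-entry M e e₂ refl)
      -- The neighbours of `v` are `q₁` and `q₃`. The pivot `q₁` deletes the edges from `v` and from
      -- `q₂` to `q₃`, which cuts these two vertices off from the rest.
      cases false true e₂ e₃ _ (no none) = corank≥2-resp-↭ p₁
        (corank≥2-unpivot _≟_ ((v≢q₁ ∘ sym) ∷ q₁≢q₂ ∷ q₁≢q₃ ∷ q₁∉qs)
          (corank≥2-split x const (here refl) (there (there (here refl))) xᵥ (x-else (v≢q₃ ∘ sym) (q₂≢q₃ ∘ sym))))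
        where
        x : V → Bool
        x j = does (j ≟ v) ∨ does (j ≟ q₂)
        xᵥ : x v ≡ true
        xᵥ = cong (_∨ does (v ≟ q₂)) (dec-true (v ≟ v) refl)
        x₂ : x q₂ ≡ true
        x₂ = trans (cong (does (q₂ ≟ v) ∨_) (dec-true (q₂ ≟ q₂) refl)) (∨-zeroʳ _)
        x-else : ∀ {j} → j ≢ v → j ≢ q₂ → x j ≡ false
        x-else j≢v j≢q₂ = cong₂ _∨_ (dec-false (_ ≟ v) j≢v) (dec-false (_ ≟ q₂) j≢q₂)
        x-rest : ∀ {j} → j ∈ q₃ ∷ qs → x j ≡ false
        x-rest (here refl) = x-else (v≢q₃ ∘ sym) (q₂≢q₃ ∘ sym)
        x-rest (there j∈)  = x-else (All.lookup v∉qs j∈ ∘ sym) (All.lookup q₂∉qs j∈ ∘ sym)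
        sⱼ : ∀ {j} → j ∈ qs → M v j ≡ false
        sⱼ j∈ = ¬-not (All.lookup (All.¬Any⇒All¬ qs none) j∈)
        v-rest : ∀ {j} → j ∈ q₃ ∷ qs → pivot M q₁ v j ≡ false
        v-rest (here refl) = pivot-entry M e₃ e₁ (m₁₃ e₃)
        v-rest (there j∈)  = pivot-entry M (sⱼ j∈) e₁ (m₁ j∈ (sⱼ j∈))
        q₂-rest : ∀ {j} → j ∈ q₃ ∷ qs → pivot M q₁ q₂ j ≡ false
        q₂-rest (here refl) = pivot-entry M (m₂₃ e₂ e₃) (sym-entry (m₁₂ e₂)) (m₁₃ e₃)
        q₂-rest (there j∈)  = pivot-entry M (m₂ j∈ e₂ (sⱼ j∈)) (sym-entry (m₁₂ e₂)) (m₁ j∈ (sⱼ j∈))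
        half : ∀ {i j} → i ∈ v ∷ q₂ ∷ q₃ ∷ qs → j ∈ v ∷ q₂ ∷ q₃ ∷ qs →
               x i ≡ true → x j ≡ false → pivot M q₁ i j ≡ false
        half _ (here refl) _ xⱼ with () ← trans (sym xᵥ) xⱼ
        half _ (there (here refl)) _ xⱼ with () ← trans (sym x₂) xⱼ
        half (here refl) (there (there j∈)) _ _ = v-rest j∈
        half (there (here refl)) (there (there j∈)) _ _ = q₂-rest j∈
        half (there (there i∈)) _ xᵢ _ with () ← trans (sym xᵢ) (x-rest i∈)
        const : LocallyConstant (pivot M q₁) (v ∷ q₂ ∷ q₃ ∷ qs) x
        const {i} {j} i∈ j∈ e with x i in xᵢ | x j in xⱼ
        ... | true  | true  = refl
        ... | false | false = refl
        ... | true  | false with () ← trans (sym e) (half i∈ j∈ xᵢ xⱼ)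
        ... | false | true  with () ← trans (sym e)
                              (trans (pivot-sym q₁ M-sym i j) (half j∈ i∈ xⱼ xᵢ))

    go : ∀ {q} → Line (pivot M v) q → Unique (v ∷ q) → length q ≡ suc k → Dichotomy M (v ∷ q)
    go (single q₁) ((v≢q₁ ∷ []) ∷ _) _ with M v q₁ in s₁
    ... | true  = inj₂ (_ , ↭-refl , link s₁ [] (single q₁))
    ... | false = inj₁ (corank≥2-split x const (here refl) (there (here refl)) (dec-yes refl) (dec-no (v≢q₁ ∘ sym)))
      where
      x : V → Bool
      x j = does (j ≟ v)
      dec-yes : ∀ {j} → j ≡ v → x j ≡ true
      dec-yes = dec-true (_ ≟ v)
      dec-no : ∀ {j} → j ≢ v → x j ≡ false
      dec-no = dec-false (_ ≟ v)
      const : LocallyConstant M (v ∷ q₁ ∷ []) x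
      const (here refl) (here refl) _ = refl
      const (here refl) (there (here refl)) e with () ← trans (sym e) s₁
      const (there (here refl)) (here refl) e with () ← trans (sym e) (trans (M-sym _ _) s₁)
      const (there (here refl)) (there (here refl)) _ = refl
    go line@(link {q₁} {q₂} {qs} t₁₂ t₁ _) l! ∣q∣ =
      cases (M v q₁) (M v q₂) refl refl (any? (λ z → M v z ≟ᵇ true) qs) line
      where
      open Step IH M-sym l! (cong suc ∣q∣)

      module _ (none : ¬ Any (λ z → M v z ≡ true) qs) where
        sⱼ : ∀ {j} → j ∈ qs → M v j ≡ false
        sⱼ j∈ = ¬-not (All.lookup (All.¬Any⇒All¬ qs none) j∈)

      cases : ∀ s₁ s₂ → M v q₁ ≡ s₁ → M v q₂ ≡ s₂ → Dec (Any (λ z → M v z ≡ true) qs) →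
              Line (pivot M v) (q₁ ∷ q₂ ∷ qs) → Dichotomy M (v ∷ q₁ ∷ q₂ ∷ qs)
      -- Complementing around `v` does not touch `q₁`, which stays an end with the one neighbour
      -- `q₂`.
      cases false _ e₁ _ _ _ = leaf (↭-swap q₁ v ↭-refl) (there (here refl))
        (unpivot-entry M t₁₂ (trans (M-sym _ _) e₁) refl) λ where
          (here refl) _           → trans (M-sym _ _) e₁
          (there (here refl)) q≢q → contradiction refl q≢q
          (there (there j∈)) _    → unpivot-entry M (All.lookup t₁ j∈) (trans (M-sym _ _) e₁) refl
      cases true _ e₁ e₂ (yes some) line@(link _ _ (link _ _ _)) =
        inj₁ (far line l! ∣q∣ e₁ refl refl some)
      cases true false e₁ e₂ (no none) _ = leaf ↭-refl (here refl) e₁ λ where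
          (here refl) q≢q       → contradiction refl q≢q
          (there (here refl)) _ → e₂
          (there (there j∈)) _  → sⱼ none j∈
      -- Complementing the pair `q₁`, `q₂` deletes the edge between them, so `v` is the only
      -- neighbour of `q₁` in `M`.
      cases true true e₁ e₂ (no none) _ =
        leaf (↭-swap q₁ v ↭-refl) (here refl) (trans (M-sym _ _) e₁) λ where
          (here refl) q≢q       → contradiction refl q≢q
          (there (here refl)) _ → unpivot-entry M t₁₂ (trans (M-sym _ _) e₁) e₂
          (there (there j∈)) _  →
            unpivot-entry M (All.lookup t₁ j∈) (trans (M-sym _ _) e₁) (sⱼ none j∈)

  -- Fiedler's theorem for `suc k` vertices; the shift leaves out the empty list, which is not
  -- `Linear`.
  dichotomy : ∀ k {M} → SymmetricMatrix M → ∀ {l : List V} → Unique l → length l ≡ suc k →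
              Dichotomy M l
  dichotomy zero    M-sym {v ∷ []} _ _ = inj₂ (_ , ↭-refl , single v)
  dichotomy (suc k) M-sym {v ∷ l} l!@(v∉l ∷ vl!) ∣l∣
    with dichotomy k (pivot-sym v M-sym) vl! (suc-injective ∣l∣)
  ... | inj₁ c = inj₁ (corank≥2-unpivot _≟_ v∉l c)
  ... | inj₂ (q , q↭l , line) = dichotomy-resp-↭ vq↭vl
          (pivoted-line⇒dichotomy (dichotomy k) M-sym line (unique-resp-↭ (↭-sym vq↭vl) l!)
             (trans (↭-length q↭l) (suc-injective ∣l∣)))
    where
    vq↭vl : v ∷ q ↭ v ∷ l
    vq↭vl = prep v q↭l

-- The walk around the vertex

iterate-+ : ∀ {A : Set} (f : A → A) x m k → iterate f x (m + k) ≡ iterate f (iterate f x m) k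
iterate-+ f x zero    k = refl
iterate-+ f x (suc m) k = iterate-+ f (f x) m k

iterate-suc : ∀ {A : Set} (f : A → A) x k → iterate f x (suc k) ≡ f (iterate f x k)
iterate-suc f x zero    = refl
iterate-suc f x (suc k) = iterate-suc f (f x) k

iterate-injective : ∀ {A : Set} {f : A → A} → Injective _≡_ _≡_ f →
                    ∀ k → Injective _≡_ _≡_ (λ x → iterate f x k)
iterate-injective inj zero    = id
iterate-injective inj (suc k) = inj ∘ iterate-injective inj k

least : {P : ℕ → Set} → Decidable P → ∀ m → P m → ∃[ k ] P k × (∀ {j} → j < k → ¬ P j)
least P? zero    pm = zero , pm , λ ()
least P? (suc m) pm with P? zero
... | yes p₀ = zero , p₀ , λ ()
... | no ¬p₀ with least (P? ∘ suc) m pm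
... | k , pk , below = suc k , pk , λ { {zero} _ → ¬p₀ ; {suc j} (s<s j<k) → below j<k }

segment : ∀ {m} → Flag m → Fin m × Bool
segment (e , i , s) = e , i

segment-≡ : ∀ {m} {x y : Flag m} → segment x ≡ segment y → x ≡ y ⊎ x ≡ across y
segment-≡ {x = _ , _ , false} {_ , _ , false} refl = inj₁ refl
segment-≡ {x = _ , _ , false} {_ , _ , true}  refl = inj₂ refl
segment-≡ {x = _ , _ , true}  {_ , _ , false} refl = inj₂ refl
segment-≡ {x = _ , _ , true}  {_ , _ , true}  refl = inj₁ refl

across-involutive : ∀ {m} (x : Flag m) → across (across x) ≡ x
across-involutive (e , i , s) = cong (λ t → e , i , t) (not-involutive s)

across-no-fixed : ∀ {m} (x : Flag m) → across x ≢ x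
across-no-fixed (e , i , true)  ()
across-no-fixed (e , i , false) ()

encodeBool : Bool → Fin 2
encodeBool = Inverse.from 2↔Bool

encodeBool-injective : ∀ {a b} → encodeBool a ≡ encodeBool b → a ≡ b
encodeBool-injective {true}  {true}  _ = refl
encodeBool-injective {false} {false} _ = refl

encodeSegment : ∀ {m} → Fin m × Bool → Fin (m * 2)
encodeSegment (e , i) = combine e (encodeBool i)

encodeSegment-injective : ∀ {m} {x y : Fin m × Bool} → encodeSegment x ≡ encodeSegment y → x ≡ y
encodeSegment-injective {x = e , i} {f , j} eq with combine-injective e _ f _ eq
... | refl , i≡j = cong (e ,_) (encodeBool-injective i≡j)

decodeSegment : ∀ {m} → Fin (m * 2) → Fin m × Bool
decodeSegment {m} k = map₂ (Inverse.to 2↔Bool) (remQuot {m} 2 k)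

decodeSegment-injective : ∀ {m} {x y : Fin (m * 2)} → decodeSegment {m} x ≡ decodeSegment y → x ≡ y
decodeSegment-injective {m} {x} {y} eq = trans (sym (retract x)) (trans (cong encodeSegment eq) (retract y))
  where
  retract : ∀ x → encodeSegment (decodeSegment {m} x) ≡ x
  retract x = trans (cong (combine (proj₁ (remQuot {m} 2 x))) (Inverse.strictlyInverseʳ 2↔Bool _))
                    (combine-remQuot {m} 2 x)

encodeFlag : ∀ {m} → Flag m → Fin (m * 2 * 2)
encodeFlag {m} (e , i , s) = combine (encodeSegment (e , i)) (encodeBool s)

encodeFlag-injective : ∀ {m} {x y : Flag m} → encodeFlag x ≡ encodeFlag y → x ≡ y
encodeFlag-injective {x = e , i , s} {f , j , t} eq
  with combine-injective (encodeSegment (e , i)) _ (encodeSegment (f , j)) _ eq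
... | p , q with encodeSegment-injective {x = e , i} {f , j} p | encodeBool-injective q
... | refl | refl = refl

module Walk {m : ℕ} (arc : Flag m → Flag m)
  (arc-involutive : ∀ x → arc (arc x) ≡ x) (arc-no-fixed : ∀ x → arc x ≢ x)
  (connected : ∀ x y → FlagOrbits.SameOrbit m (across ∷ arc ∷ []) x y) where

  step : Flag m → Flag m
  step x = across (arc x)

  step-injective : Injective _≡_ _≡_ step
  step-injective {x} {y} eq = trans (sym (unstep x)) (trans (cong (arc ∘ across) eq) (unstep y))
    where
    unstep : ∀ x → arc (across (step x)) ≡ x
    unstep x = trans (cong arc (across-involutive (arc x))) (arc-involutive x)

  module From (y : Flag m) where

    walk : ℕ → Flag m
    walk = iterate step y

    walk-suc : ∀ k → walk (suc k) ≡ step (walk k)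
    walk-suc = iterate-suc step y

    -- An arc joining two positions would force, moving its ends towards each
    -- other, a fixed point of arc or of across.
    arc-walk : ∀ l d → arc (walk l) ≢ walk (d + l)
    arc-walk l zero          eq = arc-no-fixed _ eq
    arc-walk l (suc zero)    eq = across-no-fixed _ (sym (trans eq (walk-suc l)))
    arc-walk l (suc (suc d)) eq = arc-walk (suc l) d (begin
      arc (walk (suc l))                     ≡⟨ cong arc (walk-suc l) ⟩
      arc (across (arc (walk l)))            ≡⟨ cong (arc ∘ across) eq ⟩
      arc (across (walk (suc (suc d + l))))  ≡⟨ cong (arc ∘ across) (walk-suc (suc d + l)) ⟩
      arc (across (step (walk (suc d + l)))) ≡⟨ cong arc (across-involutive _) ⟩
      arc (arc (walk (suc d + l)))           ≡⟨ arc-involutive _ ⟩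
      walk (suc d + l)                       ≡⟨ cong walk (+-suc d l) ⟨
      walk (d + suc l)                       ∎)
      where open ≡-Reasoning

    -- The walk orients the vertex circle: the flags from which it enters arcs are disjoint from
    -- those at which it leaves them.
    walk≢arc-walk : ∀ k l → walk k ≢ arc (walk l)
    walk≢arc-walk k l eq with ≤-total l k
    ... | inj₁ l≤k = arc-walk l (k ∸ l) (trans (sym eq) (cong walk (sym (m∸n+n≡m l≤k))))
    ... | inj₂ k≤l = arc-walk k (l ∸ k) (trans (cong arc eq)
                       (trans (arc-involutive _) (cong walk (sym (m∸n+n≡m k≤l)))))

    walk-cancel : ∀ {i j} → i < j → walk i ≡ walk j → walk (j ∸ i) ≡ y
    walk-cancel {i} {j} i<j eq = sym (iterate-injective step-injective i (begin
      walk i                          ≡⟨ eq ⟩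
      walk j                          ≡⟨ cong walk (m∸n+n≡m (<⇒≤ i<j)) ⟨
      walk (j ∸ i + i)                ≡⟨ iterate-+ step y (j ∸ i) i ⟩
      iterate step (walk (j ∸ i)) i   ∎))
      where open ≡-Reasoning

    recurs : ∃[ k ] walk (suc k) ≡ y
    recurs with pigeonhole (n<1+n (m * 2 * 2)) (encodeFlag ∘ walk ∘ toℕ)
    ... | i , j , i<j , eq with toℕ j ∸ toℕ i | m<n⇒0<n∸m i<j | walk-cancel i<j (encodeFlag-injective eq)
    ... | suc k | _ | closes = k , closes

    record IsPeriod (p : ℕ) : Set where
      field
        closed   : walk p ≡ y
        positive : 0 < p
        minimal  : ∀ {k} → 0 < k → k < p → walk k ≢ y

    ∃-period : ∃[ p ] IsPeriod p
    ∃-period with least (λ k → walk (suc k) ≟ᶠ y) (proj₁ recurs) (proj₂ recurs)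
    ... | k₀ , closed , below = suc k₀ , record
      { closed = closed ; positive = z<s ; minimal = λ { {suc k} _ (s<s k<k₀) → below k<k₀ } }

  module Cycle (y : Flag m) {period : ℕ} (isPeriod : From.IsPeriod y period) where

    open From y public using (walk; walk-suc)
    open From y using (walk-cancel; walk≢arc-walk)
    open From.IsPeriod isPeriod public

    walk-injective′ : ∀ {i j} → i < j → j < period → walk i ≢ walk j
    walk-injective′ {i} {j} i<j j<p eq =
      minimal (m<n⇒0<n∸m i<j) (≤-<-trans (m∸n≤m j i) j<p) (walk-cancel i<j eq)

    walk-injective : ∀ {i j} → i < period → j < period → walk i ≡ walk j → i ≡ j
    walk-injective {i} {j} i<p j<p eq with <-cmp i j
    ... | tri< i<j _ _ = contradiction eq (walk-injective′ i<j j<p)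
    ... | tri≈ _ i≡j _ = i≡j
    ... | tri> _ _ j<i = contradiction (sym eq) (walk-injective′ j<i i<p)

    across-walk : ∀ {k} → k < period → ∃[ l ] l < period × across (walk k) ≡ arc (walk l)
    across-walk {zero}  _   = pred period , pred<period , (begin
      across y                                 ≡⟨ cong across closed ⟨
      across (walk period)                     ≡⟨ cong (across ∘ walk) (suc-pred period) ⟨
      across (walk (suc (pred period)))        ≡⟨ cong across (walk-suc (pred period)) ⟩
      across (across (arc (walk (pred period)))) ≡⟨ across-involutive _ ⟩
      arc (walk (pred period))                 ∎)
      where
      open ≡-Reasoning
      instance
        period≢0 : NonZero period
        period≢0 = >-nonZero positive
      pred<period : pred period < period
      pred<period = ≤-reflexive (suc-pred period)
    across-walk {suc k} k<p = k , <-trans (n<1+n k) k<p ,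
      trans (cong across (walk-suc k)) (across-involutive _)

    step-walk : ∀ {k} → k < period → ∃[ l ] l < period × step (walk k) ≡ walk l
    step-walk {k} k<p with suc k <? period
    ... | yes k′<p = suc k , k′<p , sym (walk-suc k)
    ... | no k′≮p  = zero , positive , (begin
      step (walk k) ≡⟨ walk-suc k ⟨
      walk (suc k)  ≡⟨ cong walk (≤-antisym k<p (≮⇒≥ k′≮p)) ⟩
      walk period   ≡⟨ closed ⟩
      y             ∎)
      where open ≡-Reasoning

    -- The walk sees only one corner of a segment: the other one, `across (walk j)`, is the far end
    -- of an arc of the walk and so never on the walk.
    segment-walk-injective : ∀ {i j} → i < period → j < period →
                             segment (walk i) ≡ segment (walk j) → i ≡ j
    segment-walk-injective {i} {j} i<p j<p eq with segment-≡ eq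
    ... | inj₁ same = walk-injective i<p j<p same
    ... | inj₂ opposite with across-walk j<p
    ... | l , _ , eq′ = ⊥-elim (walk≢arc-walk i l (trans opposite eq′))

    OnArc : ℕ → Flag m → Set
    OnArc k z = z ≡ walk k ⊎ z ≡ arc (walk k)

    onArc-arc : ∀ {k z} → OnArc k z → OnArc k (arc z)
    onArc-arc (inj₁ refl) = inj₂ refl
    onArc-arc (inj₂ refl) = inj₁ (arc-involutive _)

    onArc-unique : ∀ {i j z} → i < period → j < period → OnArc i z → OnArc j z → i ≡ j
    onArc-unique i<p j<p (inj₁ p) (inj₁ q) = walk-injective i<p j<p (trans (sym p) q)
    onArc-unique {i} {j} i<p j<p (inj₁ p) (inj₂ q) = ⊥-elim (walk≢arc-walk i j (trans (sym p) q))
    onArc-unique {i} {j} i<p j<p (inj₂ p) (inj₁ q) = ⊥-elim (walk≢arc-walk j i (trans (sym q) p))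
    onArc-unique i<p j<p (inj₂ p) (inj₂ q) = walk-injective i<p j<p
      (trans (sym (arc-involutive _)) (trans (cong arc (trans (sym p) q)) (arc-involutive _)))

    Reached : Flag m → Set
    Reached z = ∃[ k ] k < period × OnArc k z

    reached-arc : ∀ {z} → Reached z → Reached (arc z)
    reached-arc (k , k<p , on) = k , k<p , onArc-arc {k} on

    reached-across : ∀ {z} → Reached z → Reached (across z)
    reached-across (k , k<p , inj₁ refl) with across-walk k<p
    ... | l , l<p , eq = l , l<p , inj₂ eq
    reached-across (k , k<p , inj₂ refl) with step-walk k<p
    ... | l , l<p , eq = l , l<p , inj₁ eq

    abstract
      -- The arcs of the walk are closed under both generators, which act transitively because there
      -- is one vertex.
      reached : ∀ z → Reached z
      reached z = proj₁ (Eq.fold equivalence generator (connected y z)) (zero , positive , inj₁ refl)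
        where
        equivalence : IsEquivalence (λ u v → (Reached u → Reached v) × (Reached v → Reached u))
        equivalence = record
          { refl  = id , id
          ; sym   = λ (p , q) → q , p
          ; trans = λ (p , q) (p′ , q′) → p′ ∘ p , q ∘ q′
          }
        generator : ∀ {u v} → Any (λ g → g u ≡ v) (across ∷ arc ∷ []) →
                    (Reached u → Reached v) × (Reached v → Reached u)
        generator {u} (here refl) = reached-across , subst Reached (across-involutive u) ∘ reached-across
        generator {u} (there (here refl)) = reached-arc , subst Reached (arc-involutive u) ∘ reached-arc

    segment-reached : ∀ σ → ∃[ k ] k < period × segment (walk k) ≡ σ
    segment-reached (e , i) with reached (e , i , false)
    ... | k , k<p , inj₁ eq = k , k<p , cong segment (sym eq)
    ... | k , k<p , inj₂ eq with step-walk k<p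
    ... | l , l<p , eq′ = l , l<p , cong segment (trans (sym eq′) (cong across (sym eq)))

    -- Counting by injections both ways: one turn passes each of the `m * 2` edge ends, and none
    -- twice.
    period≡2m : period ≡ 2 * m
    period≡2m = trans (≤-antisym
      (injective⇒≤ {f = λ k → encodeSegment (segment (walk (toℕ k)))} λ eq →
        toℕ-injective (segment-walk-injective (toℕ<n _) (toℕ<n _) (encodeSegment-injective eq)))
      (injective⇒≤ {f = position} λ {x} {y} eq → decodeSegment-injective
        (trans (sym (position-segment x)) (trans (cong (segment ∘ walk ∘ toℕ) eq) (position-segment y)))))
      (*-comm m 2)
      where
      position : Fin (m * 2) → Fin period
      position x = fromℕ< (proj₁ (proj₂ (segment-reached (decodeSegment x))))
      position-segment : ∀ x → segment (walk (toℕ (position x))) ≡ decodeSegment x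
      position-segment x = trans (cong (segment ∘ walk) (toℕ-fromℕ< (proj₁ (proj₂ (segment-reached (decodeSegment x))))))
                                 (proj₂ (proj₂ (segment-reached (decodeSegment x))))

  abstract
    full-turn : ∀ y → From.IsPeriod y (2 * m)
    full-turn y with From.∃-period y
    ... | p , isPeriod = subst (From.IsPeriod y) (Cycle.period≡2m y isPeriod) isPeriod

-- Colourings of the boundary components

δ : ∀ {m} → Fin m → Fin m → Bool
δ f e = does (e ≟ⁿ f)

⨁-δ : ∀ {m} (x : Fin m → Bool) e → ⨁ (allFin m) (λ f → δ f e ∧ x f) ≡ x e
⨁-δ {m} x e = trans
  (⨁-single (allFin⁺ m) (∈-allFin e) λ {f} _ f≢e → cong (_∧ x f) (dec-false (e ≟ⁿ f) (f≢e ∘ sym)))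
  (cong (_∧ x e) (dec-true (e ≟ⁿ e) refl))

segments : ∀ m → List (Fin m × Bool)
segments m = cartesianProduct (allFin m) (false ∷ true ∷ [])

⨁-segments : ∀ {A : Set} (x : A → Bool) l →
             ⨁ (cartesianProduct l (false ∷ true ∷ [])) (x ∘ proj₁) ≡ false
⨁-segments x []      = refl
⨁-segments x (a ∷ l) = trans (sym (xor-assoc (x a) (x a) _))
  (cong₂ _xor_ (xor-same (x a)) (⨁-segments x l))

module Colouring {m : ℕ} (arc : Flag m → Flag m)
  (arc-involutive : ∀ x → arc (arc x) ≡ x) (arc-no-fixed : ∀ x → arc x ≢ x)
  (connected : ∀ x y → FlagOrbits.SameOrbit m (across ∷ arc ∷ []) x y) where

  open Walk arc arc-involutive arc-no-fixed connected

  N : ℕ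
  N = 2 * m

  -- The total jump along `k` steps. The segments crossed are those at positions 1 to `k`; the
  -- segment of `y` itself is left out.
  crossings : (Fin m → Bool) → Flag m → ℕ → Bool
  crossings x y zero    = false
  crossings x y (suc k) = x (edgeOf (step y)) xor crossings x (step y) k

  crossings-+ : ∀ x y j k → crossings x y (j + k) ≡ crossings x y j xor crossings x (iterate step y j) k
  crossings-+ x y zero    k = refl
  crossings-+ x y (suc j) k = trans (cong (x (edgeOf (step y)) xor_) (crossings-+ x (step y) j k))
    (sym (xor-assoc (x (edgeOf (step y))) _ _))

  crossings-suc : ∀ x y k → crossings x y (suc k) ≡ crossings x y k xor x (edgeOf (iterate step y (suc k)))
  crossings-suc x y k = begin
    crossings x y (suc k) ≡⟨ cong (crossings x y) (+-comm 1 k) ⟩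
    crossings x y (k + 1) ≡⟨ crossings-+ x y k 1 ⟩
    crossings x y k xor (x (edgeOf (step (iterate step y k))) xor false)
      ≡⟨ cong (crossings x y k xor_) (xor-identityʳ _) ⟩
    crossings x y k xor x (edgeOf (step (iterate step y k)))
      ≡⟨ cong (λ z → crossings x y k xor x (edgeOf z)) (iterate-suc step y k) ⟨
    crossings x y k xor x (edgeOf (iterate step y (suc k))) ∎
    where open ≡-Reasoning

  crossings-hit : ∀ x y k → crossings x y k ≡ true →
                  ∃[ i ] 0 < i × i ≤ k × x (edgeOf (iterate step y i)) ≡ true
  crossings-hit x y (suc k) odd with x (edgeOf (step y)) in eq
  ... | true  = 1 , z<s , s≤s z≤n , eq
  ... | false with crossings-hit x (step y) k odd
  ... | i , _ , i≤k , hit = suc i , z<s , s≤s i≤k , hit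

  crossings-none : ∀ x y k → (∀ {j} → 0 < j → j ≤ k → x (edgeOf (iterate step y j)) ≡ false) →
                   crossings x y k ≡ false
  crossings-none x y zero    none = refl
  crossings-none x y (suc k) none = cong₂ _xor_ (none z<s (s≤s z≤n))
    (crossings-none x (step y) k λ _ j≤k → none z<s (s≤s j≤k))

  crossings-single : ∀ x y k {i} → 0 < i → i ≤ k → x (edgeOf (iterate step y i)) ≡ true →
    (∀ {j} → 0 < j → j ≤ k → j ≢ i → x (edgeOf (iterate step y j)) ≡ false) →
    crossings x y k ≡ true
  crossings-single x y (suc k) {suc zero} _ _ hit others = cong₂ _xor_ hit
    (crossings-none x (step y) k λ {j} 0<j j≤k → others z<s (s≤s j≤k)
      λ eq → <⇒≢ 0<j (sym (suc-injective eq)))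
  crossings-single x y (suc k) {suc (suc i)} _ (s≤s i≤k) hit others = cong₂ _xor_
    (others z<s (s≤s z≤n) λ ())
    (crossings-single x (step y) k z<s i≤k hit λ _ j≤k j≢i →
      others z<s (s≤s j≤k) (j≢i ∘ suc-injective))

  crossings-tabulate : ∀ x y k →
    crossings x y k ≡ ⨁ (tabulate {n = k} (λ t → segment (iterate step (step y) (toℕ t)))) (x ∘ proj₁)
  crossings-tabulate x y zero    = refl
  crossings-tabulate x y (suc k) = cong (x (edgeOf (step y)) xor_) (crossings-tabulate x (step y) k)

  -- A full turn meets both ends of every edge, and their contributions cancel.
  crossings-full : ∀ x y → crossings x y N ≡ false
  crossings-full x y = begin
    crossings x y N                ≡⟨ crossings-tabulate x y N ⟩
    ⨁ visited (x ∘ proj₁)          ≡⟨ ⨁-↭ (x ∘ proj₁) visited↭segments ⟩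
    ⨁ (segments m) (x ∘ proj₁)     ≡⟨ ⨁-segments x (allFin m) ⟩
    false                          ∎
    where
    open ≡-Reasoning
    open Cycle (step y) (full-turn (step y))
    visited : List (Fin m × Bool)
    visited = tabulate {n = N} (λ t → segment (walk (toℕ t)))
    ∈segments : ∀ σ → σ ∈ segments m
    ∈segments (e , i) = ∈-cartesianProduct⁺ (∈-allFin e) (bool i)
      where
      bool : ∀ b → b ∈ false ∷ true ∷ []
      bool false = here refl
      bool true  = there (here refl)
    ∈visited : ∀ σ → σ ∈ visited
    ∈visited σ with segment-reached σ
    ... | k , k<N , refl = subst (_∈ visited) (cong (segment ∘ walk) (toℕ-fromℕ< k<N))
                             (∈-tabulate⁺ {f = segment ∘ walk ∘ toℕ} (fromℕ< k<N))
    visited↭segments : visited ↭ segments m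
    visited↭segments = ∼bag⇒↭ (unique∧set⇒bag
      (tabulate⁺ λ eq → toℕ-injective (segment-walk-injective (toℕ<n _) (toℕ<n _) eq))
      (cartesianProduct⁺ (allFin⁺ m) (((λ ()) ∷ []) ∷ ([] ∷ [])))
      (λ {σ} → mk⇔ (λ _ → ∈segments σ) (λ _ → ∈visited σ)))

  crossings-linear : ∀ x y k → crossings x y k ≡ ⨁ (allFin m) (λ f → crossings (δ f) y k ∧ x f)
  crossings-linear x y zero    = sym (⨁-false (allFin m) λ _ → refl)
  crossings-linear x y (suc k) = begin
    x e xor crossings x (step y) k
      ≡⟨ cong₂ _xor_ (sym (⨁-δ x e)) (crossings-linear x (step y) k) ⟩
    ⨁ (allFin m) (λ f → δ f e ∧ x f) xor ⨁ (allFin m) (λ f → c f ∧ x f)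
      ≡⟨ ⨁-xor _ _ (allFin m) ⟨
    ⨁ (allFin m) (λ f → (δ f e ∧ x f) xor (c f ∧ x f))
      ≡⟨ ⨁-cong (allFin m) (λ {f} _ → sym (∧-distribʳ-xor (x f) (δ f e) (c f))) ⟩
    ⨁ (allFin m) (λ f → (δ f e xor c f) ∧ x f) ∎
    where
    open ≡-Reasoning
    e = edgeOf (step y)
    c : Fin m → Bool
    c f = crossings (δ f) (step y) k

  -- A function on arcs whose jump is the same at both ends of an edge. This is the part of the
  -- boundary condition that does not depend on the twists; `IsTwisted` is the rest.
  record IsColouring (x : Fin m → Bool) (c : Flag m → Bool) : Set where
    field
      arc-invariant : ∀ z → c (arc z) ≡ c z
      across-jump   : ∀ z → c (across z) ≡ c z xor x (edgeOf z)

    along-walk : ∀ y k → c (iterate step y k) ≡ c y xor crossings x y k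
    along-walk y zero    = sym (xor-identityʳ (c y))
    along-walk y (suc k) = begin
      c (iterate step (step y) k)                       ≡⟨ along-walk (step y) k ⟩
      c (step y) xor crossings x (step y) k             ≡⟨ cong (_xor crossings x (step y) k) (trans (across-jump (arc y)) (cong (_xor x e) (arc-invariant y))) ⟩
      (c y xor x e) xor crossings x (step y) k          ≡⟨ xor-assoc (c y) (x e) _ ⟩
      c y xor (x e xor crossings x (step y) k)          ∎
      where
      open ≡-Reasoning
      e = edgeOf (arc y)

  module Base (y₀ : Flag m) where

    open Cycle y₀ (full-turn y₀)

    pos : Flag m → ℕ
    pos z = proj₁ (reached z)

    h : (Fin m → Bool) → Flag m → Bool
    h x z = crossings x y₀ (pos z)

    h-at : ∀ x {k z} → k ≤ N → OnArc k z → h x z ≡ crossings x y₀ k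
    h-at x {k} {z} k≤N on with reached z
    ... | i , i<N , on′ with m≤n⇒m<n∨m≡n k≤N
    ... | inj₁ k<N  = cong (crossings x y₀) (onArc-unique i<N k<N on′ on)
    ... | inj₂ refl = trans (cong (crossings x y₀) (onArc-unique i<N positive on′ (at-zero on)))
                            (sym (crossings-full x y₀))
      where
      at-zero : OnArc N z → OnArc 0 z
      at-zero (inj₁ p) = inj₁ (trans p closed)
      at-zero (inj₂ p) = inj₂ (trans p (cong arc closed))

    h-jump : ∀ x k z → k < N → z ≡ arc (walk k) → h x (across z) ≡ h x z xor x (edgeOf z)
    h-jump x k z k<N refl = begin
      h x (step (walk k))                                       ≡⟨ h-at x {suc k} k<N (inj₁ (sym (walk-suc k))) ⟩
      crossings x y₀ (suc k)                                    ≡⟨ crossings-suc x y₀ k ⟩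
      crossings x y₀ k xor x (edgeOf (walk (suc k)))            ≡⟨ cong₂ _xor_ (h-at x {k} (<⇒≤ k<N) (inj₂ refl)) (cong (x ∘ edgeOf) (sym (walk-suc k))) ⟨
      h x (arc (walk k)) xor x (edgeOf (arc (walk k)))          ∎
      where open ≡-Reasoning

    h-isColouring : ∀ x → IsColouring x (h x)
    h-isColouring x = record { arc-invariant = arc-inv ; across-jump = λ z → jump z (reached z) }
      where
      arc-inv : ∀ z → h x (arc z) ≡ h x z
      arc-inv z = case reached z of λ (k , k<N , on) →
        trans (h-at x (<⇒≤ k<N) (onArc-arc {k} on)) (sym (h-at x (<⇒≤ k<N) on))

      jump : ∀ z → ∃[ k ] k < N × OnArc k z → h x (across z) ≡ h x z xor x (edgeOf z)
      jump z (k , k<N , inj₂ on) = h-jump x k z k<N on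
      jump z (k , k<N , inj₁ refl) = case across-walk k<N of λ (l , l<N , eq) →
        flip-xor (trans (cong (h x) (sym (across-involutive z))) (h-jump x l (across z) l<N eq))
        where
        flip-xor : ∀ {a b c} → a ≡ b xor c → b ≡ a xor c
        flip-xor {b = b} {c} refl = sym (trans (xor-assoc b c c)
          (trans (cong (b xor_) (xor-same c)) (xor-identityʳ b)))

    h-linear : ∀ x z → h x z ≡ ⨁ (allFin m) (λ f → h (δ f) z ∧ x f)
    h-linear x z = crossings-linear x y₀ (pos z)

    colouring-unique : ∀ {x c} → IsColouring x c → ∀ z → c z ≡ c y₀ xor h x z
    colouring-unique {x} {c} isCol z = at (reached z)
      where
      open IsColouring isCol
      at : ∃[ k ] k < N × OnArc k z → c z ≡ c y₀ xor h x z
      at (k , k<N , on) = trans (c-arc on)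
        (trans (along-walk y₀ k) (cong (c y₀ xor_) (sym (h-at x (<⇒≤ k<N) on))))
        where
        c-arc : OnArc k z → c z ≡ c (walk k)
        c-arc (inj₁ refl) = refl
        c-arc (inj₂ refl) = arc-invariant (walk k)

    -- The colouring that jumps at `f` alone, compared at the two ends of `e`. For distinct edges
    -- this is the parity of the ends of `f` between those of `e`; on the diagonal it depends on
    -- which corners are joined, hence on the twist of `e`.
    matrix : Matrix (Fin m)
    matrix e f = h (δ f) (e , false , false) xor h (δ f) (e , true , false)

    matrix-product : ∀ {x c} → IsColouring x c → ∀ e →
      ⨁ (allFin m) (λ f → matrix e f ∧ x f) ≡ c (e , false , false) xor c (e , true , false)
    matrix-product {x} {c} isCol e = begin
      ⨁ (allFin m) (λ f → (h (δ f) z₁ xor h (δ f) z₂) ∧ x f)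
        ≡⟨ ⨁-cong (allFin m) (λ {f} _ → ∧-distribʳ-xor (x f) (h (δ f) z₁) (h (δ f) z₂)) ⟩
      ⨁ (allFin m) (λ f → (h (δ f) z₁ ∧ x f) xor (h (δ f) z₂ ∧ x f))
        ≡⟨ ⨁-xor _ _ (allFin m) ⟩
      ⨁ (allFin m) (λ f → h (δ f) z₁ ∧ x f) xor ⨁ (allFin m) (λ f → h (δ f) z₂ ∧ x f)
        ≡⟨ cong₂ _xor_ (h-linear x z₁) (h-linear x z₂) ⟨
      h x z₁ xor h x z₂
        ≡⟨ cancel (c y₀) (h x z₁) (h x z₂) ⟩
      (c y₀ xor h x z₁) xor (c y₀ xor h x z₂)
        ≡⟨ cong₂ _xor_ (colouring-unique isCol z₁) (colouring-unique isCol z₂) ⟨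
      c z₁ xor c z₂ ∎
      where
      open ≡-Reasoning
      z₁ z₂ : Flag m
      z₁ = e , false , false
      z₂ = e , true , false
      open xor-∧-Solver
      cancel : ∀ a b c → b xor c ≡ (a xor b) xor (a xor c)
      cancel = solve 3 (λ a b c → b :+ c := (a :+ b) :+ (a :+ c)) refl

    -- A diagonal entry 1 adds the jump `x e`, which moves the second flag to the other corner of
    -- its end, as a half-twist does. The row vanishes exactly if `c` agrees at both ends of one
    -- free side.
    row-colouring : ∀ {x c} → IsColouring x c → ∀ (A : Fin m → Bool) e →
      row matrix A (allFin m) x e ≡ c (e , false , false) xor c (e , true , A e)
    row-colouring {x} {c} isCol A e = trans (cong (_xor (A e ∧ x e)) (matrix-product isCol e))
      (trans (xor-assoc (c (e , false , false)) _ _) (cong (c (e , false , false) xor_) (twisted (A e))))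
      where
      open IsColouring isCol
      twisted : ∀ a → c (e , true , false) xor (a ∧ x e) ≡ c (e , true , a)
      twisted false = xor-identityʳ _
      twisted true  = sym (across-jump (e , true , false))

    -- As f ≠ e, the colouring h (δ f) does not distinguish the two sides of e.
    matrix-crossings : ∀ {e f} → e ≢ f → ∀ y j → edgeOf y ≡ e → edgeOf (iterate step y j) ≡ e →
      segment (iterate step y j) ≢ segment y → matrix e f ≡ crossings (δ f) y j
    matrix-crossings {e} {f} e≢f y j y-at-e z-at-e ≢-segment = begin
      H false xor H true                       ≡⟨ opposite (endOf y) (endOf z) (λ i≡i′ →
                                                    ≢-segment (cong₂ _,_ (trans z-at-e (sym y-at-e)) (sym i≡i′))) ⟩
      H (endOf y) xor H (endOf z)              ≡⟨ cong₂ _xor_ (end y y-at-e) (end z z-at-e) ⟨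
      c y xor c z                              ≡⟨ cong (c y xor_) (along-walk y j) ⟩
      c y xor (c y xor crossings (δ f) y j)    ≡⟨ xor-assoc (c y) _ _ ⟨
      (c y xor c y) xor crossings (δ f) y j    ≡⟨ cong (_xor crossings (δ f) y j) (xor-same (c y)) ⟩
      crossings (δ f) y j                      ∎
      where
      open ≡-Reasoning
      z : Flag m
      z = iterate step y j
      c : Flag m → Bool
      c = h (δ f)
      open IsColouring (h-isColouring (δ f))
      H : Bool → Bool
      H i = c (e , i , false)
      endOf : Flag m → Bool
      endOf = proj₁ ∘ proj₂
      end : ∀ z → edgeOf z ≡ e → c z ≡ H (endOf z)
      end (_ , i , false) refl = refl
      end (_ , i , true)  refl = trans (across-jump (e , i , false))
        (trans (cong (H i xor_) (dec-false (e ≟ⁿ f) e≢f)) (xor-identityʳ (H i)))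
      opposite : ∀ i i′ → i ≢ i′ → H false xor H true ≡ H i xor H i′
      opposite false false i≢i′ = contradiction refl i≢i′
      opposite false true  _    = refl
      opposite true  false _    = xor-comm (H false) (H true)
      opposite true  true  i≢i′ = contradiction refl i≢i′

    at : Flag m → ℕ → Fin m
    at x i = edgeOf (iterate step x i)

    Alternating : Fin m → Fin m → Set
    Alternating e f = ∃[ x ] ∃[ i ] ∃[ j ] ∃[ k ]
      0 < i × i < j × j < k × k < 2 * m ×
      at x 0 ≡ e × at x i ≡ f × at x j ≡ e × at x k ≡ f

    -- The walk is restarted at position `i`; the first visit to `e` then recurs as the last one, a
    -- full turn later.
    alternating-sym : ∀ {e f} → Alternating e f → Alternating f e
    alternating-sym (x , i , j , k , 0<i , i<j , j<k , k<N , xe , if , je , kf) =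
      iterate step x i , j ∸ i , k ∸ i , N ∸ i ,
      m<n⇒0<n∸m i<j , ∸-monoˡ-< j<k (<⇒≤ i<j) , ∸-monoˡ-< k<N (<⇒≤ (<-trans i<j j<k)) ,
      ∸-monoʳ-< 0<i (<⇒≤ (<-trans i<j (<-trans j<k k<N))) ,
      if , shifted (<⇒≤ i<j) je , shifted (<⇒≤ (<-trans i<j j<k)) kf ,
      shifted (<⇒≤ (<-trans i<j (<-trans j<k k<N)))
        (trans (cong edgeOf (From.IsPeriod.closed (full-turn x))) xe)
      where
      shifted : ∀ {l g} → i ≤ l → at x l ≡ g → at (iterate step x i) (l ∸ i) ≡ g
      shifted {l} i≤l eq = trans (cong edgeOf (trans (sym (iterate-+ step x i (l ∸ i)))
                                   (cong (iterate step x) (m+[n∸m]≡n i≤l)))) eq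

    -- An edge has two ends, and the walk meets each of them once per turn.
    at-most-two : ∀ x {f i j k} → i < N → j < N → k < N → i ≢ j → j ≢ k → i ≢ k →
                  at x i ≡ f → at x j ≡ f → at x k ≢ f
    at-most-two x {f} {i} {j} {k} i<N j<N k<N i≢j j≢k i≢k if jf kf =
      cases (endOf (walk′ i)) (endOf (walk′ j)) (endOf (walk′ k)) refl refl refl
      where
      module C = Cycle x (full-turn x)
      walk′ : ℕ → Flag m
      walk′ = iterate step x
      endOf : Flag m → Bool
      endOf = proj₁ ∘ proj₂
      clash : ∀ {i j b} → i < N → j < N → i ≢ j → at x i ≡ f → at x j ≡ f →
              endOf (walk′ i) ≡ b → endOf (walk′ j) ≡ b → ⊥
      clash i<N j<N i≢j if jf ib jb = i≢j (C.segment-walk-injective i<N j<N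
        (cong₂ _,_ (trans if (sym jf)) (trans ib (sym jb))))
      cases : ∀ a b c → endOf (walk′ i) ≡ a → endOf (walk′ j) ≡ b → endOf (walk′ k) ≡ c → ⊥
      cases true  true  _     p q r = clash i<N j<N i≢j if jf p q
      cases false false _     p q r = clash i<N j<N i≢j if jf p q
      cases true  false true  p q r = clash i<N k<N i≢k if kf p r
      cases true  false false p q r = clash j<N k<N j≢k jf kf q r
      cases false true  true  p q r = clash j<N k<N j≢k jf kf q r
      cases false true  false p q r = clash i<N k<N i≢k if kf p r

    -- From one end of `e` to the other the walk crosses `f` exactly once, because the second end of
    -- `f` comes later, at `k`.
    alternating⇒matrix : ∀ {e f} → e ≢ f → Alternating e f → matrix e f ≡ true
    alternating⇒matrix {e} {f} e≢f (x , i , j , k , 0<i , i<j , j<k , k<N , xe , if , je , kf) =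
      trans (matrix-crossings e≢f x j xe je λ eq →
               <⇒≢ (<-trans 0<i i<j) (sym (C.segment-walk-injective j<N C.positive eq)))
            (crossings-single (δ f) x j 0<i (<⇒≤ i<j) (dec-true (_ ≟ⁿ f) if) λ 0<t t≤j t≢i →
               dec-false (_ ≟ⁿ f) λ tf → at-most-two x (<-trans i<j j<N) k<N (≤-<-trans t≤j j<N)
                 (<⇒≢ (<-trans i<j j<k)) (≢-sym (<⇒≢ (≤-<-trans t≤j j<k))) (≢-sym t≢i) if kf tf)
      where
      module C = Cycle x (full-turn x)
      j<N : j < N
      j<N = <-trans j<k k<N

    δ-true : ∀ {e f : Fin m} → δ f e ≡ true → e ≡ f
    δ-true {e} {f} eq with e ≟ⁿ f
    ... | yes e≡f = e≡f

    -- The two ends of `e` split the circle into two stretches. The first meets `f` an odd number of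
    -- times, and so does the second since a full turn has even parity; hence both contain an end of
    -- `f`.
    matrix⇒alternating : ∀ {e f} → e ≢ f → matrix e f ≡ true → Alternating e f
    matrix⇒alternating {e} {f} e≢f Mef = case C.segment-reached (e , true) of positions
      where
      y : Flag m
      y = e , false , false
      module C = Cycle y (full-turn y)

      positions : ∃[ j ] j < N × segment (iterate step y j) ≡ (e , true) → Alternating e f
      positions (j , j<N , eq) = case crossings-hit (δ f) y j first-odd of λ
        (i , 0<i , i≤j , if) → case crossings-hit (δ f) z (N ∸ j) second-odd of λ
        (d , 0<d , d≤N∸j , kf) → let
            k≤N = ≤-trans (+-monoʳ-≤ j d≤N∸j) (≤-reflexive (m+[n∸m]≡n (<⇒≤ j<N)))
            at-k = trans (cong edgeOf (iterate-+ step y j d)) (δ-true kf)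
          in y , i , j , j + d , 0<i ,
             ≤∧≢⇒< i≤j (λ { refl → e≢f (trans (sym je) (δ-true if)) }) ,
             m<m+n j 0<d ,
             ≤∧≢⇒< k≤N (λ k≡N → e≢f (trans (cong edgeOf (sym (trans (cong (iterate step y) k≡N) C.closed))) at-k)) ,
             refl , δ-true if , je , at-k
        where
        z : Flag m
        z = iterate step y j
        je : at y j ≡ e
        je = cong proj₁ eq
        first-odd : crossings (δ f) y j ≡ true
        first-odd = trans (sym (matrix-crossings e≢f y j refl je
                             λ eq′ → case trans (sym eq) eq′ of λ ())) Mef
        second-odd : crossings (δ f) z (N ∸ j) ≡ true
        second-odd = sym (xor-≡ (begin
          true xor crossings (δ f) z (N ∸ j)               ≡⟨ cong (_xor crossings (δ f) z (N ∸ j)) first-odd ⟨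
          crossings (δ f) y j xor crossings (δ f) z (N ∸ j) ≡⟨ crossings-+ (δ f) y j (N ∸ j) ⟨
          crossings (δ f) y (j + (N ∸ j))                  ≡⟨ cong (crossings (δ f) y) (m+[n∸m]≡n (<⇒≤ j<N)) ⟩
          crossings (δ f) y N                              ≡⟨ crossings-full (δ f) y ⟩
          false                                            ∎))
          where open ≡-Reasoning

    -- The definition treats `e` and `f` differently; symmetry is inherited from alternation.
    matrix-sym : SymmetricMatrix matrix
    matrix-sym e f with e ≟ⁿ f
    ... | yes refl = refl
    ... | no e≢f   = ≡-from-⇔ (swap e≢f) (swap (≢-sym e≢f))
      where
      swap : ∀ {e f} → e ≢ f → matrix e f ≡ true → matrix f e ≡ true
      swap e≢f Mef = alternating⇒matrix (≢-sym e≢f) (alternating-sym (matrix⇒alternating e≢f Mef))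
      ≡-from-⇔ : ∀ {a b} → (a ≡ true → b ≡ true) → (b ≡ true → a ≡ true) → a ≡ b
      ≡-from-⇔ {true}          to _    = sym (to refl)
      ≡-from-⇔ {false} {true}  _  from = from refl
      ≡-from-⇔ {false} {false} _  _    = refl

    -- Equivalently, c ∘ twist A is constant along the free sides of all edges.
    IsTwisted : (Fin m → Bool) → (Flag m → Bool) → Set
    IsTwisted A c = ∀ e s → c (e , false , s) ≡ c (e , true , A e xor s)

    -- Row `e` settles one free side of `e`. The other side follows because the colouring jumps by
    -- `x e` at both ends.
    kernel⇒colouring : ∀ {A x} → Kernel matrix A (allFin m) x → IsTwisted A (h x)
    kernel⇒colouring {A} {x} ker e = λ { false → start ; true → other }
      where
      open IsColouring (h-isColouring x)
      start : h x (e , false , false) ≡ h x (e , true , A e xor false)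
      start = trans (xor-≡ (trans (sym (row-colouring (h-isColouring x) A e)) (ker (∈-allFin e))))
                    (cong (λ s → h x (e , true , s)) (sym (xor-identityʳ (A e))))
      not-xor : ∀ a → not (a xor false) ≡ a xor true
      not-xor true  = refl
      not-xor false = refl
      other : h x (e , false , true) ≡ h x (e , true , A e xor true)
      other = begin
        h x (e , false , true)                      ≡⟨ across-jump (e , false , false) ⟩
        h x (e , false , false) xor x e             ≡⟨ cong (_xor x e) start ⟩
        h x (e , true , A e xor false) xor x e      ≡⟨ across-jump (e , true , A e xor false) ⟨
        h x (e , true , not (A e xor false))        ≡⟨ cong (λ s → h x (e , true , s)) (not-xor (A e)) ⟩
        h x (e , true , A e xor true)               ∎
        where open ≡-Reasoning

    colouring⇒kernel : ∀ {A x c} → IsColouring x c → IsTwisted A c → Kernel matrix A (allFin m) x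
    colouring⇒kernel {A} {x} {c} isCol twisted {e} _ = trans (row-colouring isCol A e)
      (trans (cong (_xor c (e , true , A e)) (trans (twisted e false)
                (cong (λ s → c (e , true , s)) (xor-identityʳ (A e)))))
             (xor-same (c (e , true , A e))))

    colouring-constant : ∀ {x c} → IsColouring x c → (∀ e → x e ≡ false) → ∀ z → c z ≡ c y₀
    colouring-constant {x} {c} isCol x≗0 z = trans (colouring-unique isCol z)
      (trans (cong (c y₀ xor_) (crossings-none x y₀ (pos z) λ _ _ → x≗0 _)) (xor-identityʳ (c y₀)))

-- Counting boundary components

≢-xor-true : ∀ {b} → b ≢ b xor true
≢-xor-true {true}  ()
≢-xor-true {false} ()

allPairs-lookup : {A : Set} {R : A → A → Set} → Symmetric R → ∀ {l} → AllPairs R l →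
                  ∀ {i j} → i ≢ j → R (lookup l i) (lookup l j)
allPairs-lookup sym (_  ∷ _)  {zero}  {zero}  i≢j = contradiction refl i≢j
allPairs-lookup sym (Rx ∷ _)  {zero}  {suc j} _   = All.lookup Rx (∈-lookup j)
allPairs-lookup sym (Rx ∷ _)  {suc i} {zero}  _   = sym (All.lookup Rx (∈-lookup i))
allPairs-lookup sym (_  ∷ Rl) {suc i} {suc j} i≢j = allPairs-lookup sym Rl (i≢j ∘ cong suc)

module OrbitCount {A : Set} (_≟_ : DecidableEquality A) (elements : List A)
                  (complete : ∀ x → x ∈ elements) (gs : List (A → A)) where

  open Orbits _≟_ elements complete

  Apart : A → A → Set
  Apart x y = ¬ SameOrbit gs x y

  private
    R : A → A → Set
    R x y = Any (λ g → g x ≡ y) gs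

    sameOrbit-decSetoid : DecSetoid _ _
    sameOrbit-decSetoid = record
      { isDecEquivalence = record
        { isEquivalence = Eq.isEquivalence R
        ; _≟_           = sameOrbit? gs
        }
      }

    representatives : List A
    representatives = deduplicate (sameOrbit? gs) elements

    representative : ∀ z → Any (SameOrbit gs z) representatives
    representative z = Any.deduplicate⁺ (sameOrbit? gs)
      (λ y~x z~x → Eq.transitive R z~x (Eq.symmetric R y~x))
      (Any.map (λ { refl → Eq.reflexive R }) (complete z))

  apart⇒≤#orbits : ∀ {l} → AllPairs Apart l → length l ≤ #orbits gs
  apart⇒≤#orbits {l} apart = injective⇒≤ {f = index} index-injective
    where
    index : Fin (length l) → Fin (length representatives)
    index i = Any.index (representative (lookup l i))
    index-injective : ∀ {i j} → index i ≡ index j → i ≡ j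
    index-injective {i} {j} eq with i ≟ⁿ j
    ... | yes i≡j = i≡j
    ... | no i≢j  = contradiction
      (Eq.transitive R (Any.lookup-index (representative (lookup l i)))
        (subst (λ k → SameOrbit gs (lookup representatives k) (lookup l j)) (sym eq)
          (Eq.symmetric R (Any.lookup-index (representative (lookup l j))))))
      (allPairs-lookup (λ ¬xy yx → ¬xy (Eq.symmetric R yx)) apart i≢j)

  #orbits≥2⇒apart : 2 ≤ #orbits gs → ∃[ x ] ∃[ y ] Apart x y
  #orbits≥2⇒apart 2≤ with representatives | deduplicate-! sameOrbit-decSetoid elements
  ... | x ∷ y ∷ _ | (xy ∷ _) ∷ _ = x , y , xy
  #orbits≥2⇒apart (s≤s ()) | _ ∷ [] | _

  #orbits≥3⇒apart : 3 ≤ #orbits gs → ∃[ x ] ∃[ y ] ∃[ z ] Apart x y × Apart x z × Apart y z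
  #orbits≥3⇒apart 3≤ with representatives | deduplicate-! sameOrbit-decSetoid elements
  ... | x ∷ y ∷ z ∷ _ | (xy ∷ xz ∷ _) ∷ (yz ∷ _) ∷ _ = x , y , z , xy , xz , yz
  #orbits≥3⇒apart (s≤s ())       | _ ∷ [] | _
  #orbits≥3⇒apart (s≤s (s≤s ())) | _ ∷ _ ∷ [] | _

  #orbits≤1⇒connected : #orbits gs ≤ 1 → ∀ x y → SameOrbit gs x y
  #orbits≤1⇒connected ≤1 x y with sameOrbit? gs x y
  ... | yes xy = xy
  ... | no ¬xy = contradiction (≤-trans (apart⇒≤#orbits ((¬xy ∷ []) ∷ [] ∷ [])) ≤1) λ { (s≤s ()) }

  #orbits≥1 : A → 1 ≤ #orbits gs
  #orbits≥1 x = apart⇒≤#orbits {x ∷ []} ([] ∷ [])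

  connected⇒#orbits≡1 : A → (∀ x y → SameOrbit gs x y) → #orbits gs ≡ 1
  connected⇒#orbits≡1 x connected = ≤-antisym
    (≮⇒≥ λ 2≤ → case #orbits≥2⇒apart 2≤ of λ (x , y , apart) → apart (connected x y))
    (#orbits≥1 x)

  Invariant : (A → Bool) → Set
  Invariant d = ∀ {g} → g ∈ gs → ∀ x → d (g x) ≡ d x

  invariant-sameOrbit : ∀ {d} → Invariant d → ∀ {x y} → SameOrbit gs x y → d x ≡ d y
  invariant-sameOrbit {d} inv = Eq.fold (On.isEquivalence d isEquivalence) λ {x} → go x inv
    where
    go : ∀ {hs} x → (∀ {g} → g ∈ hs → ∀ x → d (g x) ≡ d x) → ∀ {y} → Any (λ g → g x ≡ y) hs → d x ≡ d y
    go x inv (here refl) = sym (inv (here refl) x)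
    go x inv (there p)   = go x (inv ∘ there) p

  invariant-apart : ∀ {d} → Invariant d → ∀ {x y} → d x ≢ d y → Apart x y
  invariant-apart inv dx≢dy xy = dx≢dy (invariant-sameOrbit inv xy)

  apart-sym : ∀ {x y} → Apart x y → Apart y x
  apart-sym ¬xy yx = ¬xy (Eq.symmetric R yx)

  abstract

    orbitOf : A → A → Bool
    orbitOf o x = does (sameOrbit? gs x o)

    orbitOf-self : ∀ o → orbitOf o o ≡ true
    orbitOf-self o = dec-true (sameOrbit? gs o o) (Eq.reflexive R)

    orbitOf-apart : ∀ {o x} → Apart x o → orbitOf o x ≡ false
    orbitOf-apart {o} {x} = dec-false (sameOrbit? gs x o)

    orbitOf-true : ∀ {o x} → orbitOf o x ≡ true → SameOrbit gs x o
    orbitOf-true {o} {x} p = decidable-stable (sameOrbit? gs x o) λ apart →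
      case trans (sym p) (orbitOf-apart apart) of λ ()

    orbitOf-invariant : ∀ o → Invariant (orbitOf o)
    orbitOf-invariant o {g} g∈gs x = does-⇔
      (mk⇔ (Eq.transitive R x→gx) (Eq.transitive R (Eq.symmetric R x→gx)))
      (sameOrbit? gs (g x) o) (sameOrbit? gs x o)
      where
      x→gx : SameOrbit gs x (g x)
      x→gx = Eq.return (Any.map (λ { refl → refl }) g∈gs)

module FlagOrbitCount (m : ℕ) = OrbitCount (_≟ᶠ_ {m}) (flags m) flags-complete

module NonemptyBouquet (B : Bouquet) (y₀ : Flag (Bouquet.edges B)) where

  open Bouquet B public using (arc; arc-involutive; arc-no-fixed; isolated; one-vertex)
    renaming (ribbonGraph to R; edges to m)
  open FlagOrbits m using (SameOrbit; #orbits)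
  open FlagOrbitCount m

  isolated≡0 : isolated ≡ 0
  isolated≡0 with isolated | #orbits (across ∷ arc ∷ []) | one-vertex | #orbits≥1 (across ∷ arc ∷ []) y₀
  ... | zero  | _     | _ | _ = refl
  ... | suc i | suc o | p | _ with () ← trans (sym (+-suc i o)) (suc-injective p)

  abstract
    connected : ∀ x y → SameOrbit (across ∷ arc ∷ []) x y
    connected = #orbits≤1⇒connected _ (≤-trans (m≤n+m _ isolated) (≤-reflexive one-vertex))

  open Walk arc arc-involutive arc-no-fixed connected public
  open Colouring arc arc-involutive arc-no-fixed connected public
  open Base y₀ public

  module Twisted (A : Subset m) where

    A[_] : Fin m → Bool
    A[_] = Vec.lookup A

    τ : Flag m → Flag m
    τ = twist A

    arcᴬ : Flag m → Flag m
    arcᴬ x = τ (arc (τ x))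

    τ-across : ∀ x → τ (across x) ≡ across (τ x)
    τ-across (e , false , s) = refl
    τ-across (e , true  , s) = cong (λ t → e , true , t) (xor-not A[ e ] s)
      where
      xor-not : ∀ a b → a xor not b ≡ not (a xor b)
      xor-not true  b = refl
      xor-not false b = refl

    -- τ carries the vertex boundary of the bouquet to that of its partial Petrial.
    connectedᴬ : ∀ x y → SameOrbit (across ∷ arcᴬ ∷ []) x y
    connectedᴬ x y = subst₂ (SameOrbit (across ∷ arcᴬ ∷ [])) (twist-involutive A x) (twist-involutive A y)
      (Eq.gmap τ carry (connected (τ x) (τ y)))
      where
      carry : ∀ {x y} → Any (λ g → g x ≡ y) (across ∷ arc ∷ []) →
              Any (λ g → g (τ x) ≡ τ y) (across ∷ arcᴬ ∷ [])
      carry {x} (here refl)         = here (sym (τ-across x))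
      carry {x} (there (here refl)) = there (here (cong (τ ∘ arc) (twist-involutive A x)))

    boundary : List (Flag m → Flag m)
    boundary = along ∷ arcᴬ ∷ []

    #boundaries : ℕ
    #boundaries = #orbits boundary

    genus-formula : eulerGenus (partialPetrial R A) ≡ (+ 2) ℤ.- ((+ 1) ℤ.- (+ m) ℤ.+ (+ #boundaries))
    genus-formula = cong₂ ℤ._-_ (cong (λ c → + (2 * c)) c≡1)
      (cong₂ (λ v f → + v ℤ.- + m ℤ.+ + f) v≡1 (cong (_+ #boundaries) isolated≡0))
      where
      v≡1 : isolated + #orbits (across ∷ arcᴬ ∷ []) ≡ 1
      v≡1 = cong₂ _+_ isolated≡0 (connected⇒#orbits≡1 _ y₀ connectedᴬ)
      c≡1 : isolated + #orbits (across ∷ along ∷ arcᴬ ∷ []) ≡ 1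
      c≡1 = cong₂ _+_ isolated≡0 (connected⇒#orbits≡1 _ y₀ λ x y → Eq.map
        (λ { (here p) → here p ; (there (here p)) → there (there (here p)) }) (connectedᴬ x y))

    Kernelᴬ : (Fin m → Bool) → Set
    Kernelᴬ = Kernel matrix A[_] (allFin m)

    -- Read at the end `false`; invariance under `along` gives the same jump at the other end.
    jumps : (Flag m → Bool) → Fin m → Bool
    jumps d e = d (e , false , false) xor d (e , false , true)

    module _ {d : Flag m → Bool} (inv : Invariant boundary d) where

      private
        c : Flag m → Bool
        c = d ∘ τ

      invariant⇒twisted : IsTwisted A[_] c
      invariant⇒twisted e s = sym (trans (cong d (twist-involutive A (e , true , s)))
                                         (inv (here refl) (e , false , s)))

      -- The twist conjugates `arcᴬ` to `arc` and commutes with `across`, so `d ∘ τ` is a function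
      -- on the arcs of the original bouquet.
      invariant⇒colouring : IsColouring (jumps d) c
      invariant⇒colouring = record { arc-invariant = arc-inv ; across-jump = jump }
        where
        arc-inv : ∀ z → c (arc z) ≡ c z
        arc-inv z = trans (cong (d ∘ τ ∘ arc) (sym (twist-involutive A z))) (inv (there (here refl)) (τ z))
        recover : ∀ a b → b ≡ a xor (a xor b)
        recover true  true  = refl
        recover true  false = refl
        recover false _     = refl
        jump₀ : ∀ e s → d (e , false , not s) ≡ d (e , false , s) xor jumps d e
        jump₀ e false = recover (d (e , false , false)) (d (e , false , true))
        jump₀ e true  = trans (recover (d (e , false , true)) (d (e , false , false)))
          (cong (d (e , false , true) xor_) (xor-comm (d (e , false , true)) (d (e , false , false))))
        along-jump : ∀ e s → d (e , true , s) ≡ d (e , false , s)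
        along-jump e s = inv (here refl) (e , false , s)
        jump : ∀ z → c (across z) ≡ c z xor jumps d (edgeOf z)
        jump (e , false , s) = jump₀ e s
        jump (e , true  , s) = begin
          c (across (e , true , s))                           ≡⟨ cong d (τ-across (e , true , s)) ⟩
          d (e , true , not (A[ e ] xor s))                   ≡⟨ along-jump e _ ⟩
          d (e , false , not (A[ e ] xor s))                  ≡⟨ jump₀ e _ ⟩
          d (e , false , A[ e ] xor s) xor jumps d e          ≡⟨ cong (_xor jumps d e) (along-jump e _) ⟨
          d (e , true , A[ e ] xor s) xor jumps d e           ∎
          where open ≡-Reasoning

      invariant⇒kernel : Kernelᴬ (jumps d)
      invariant⇒kernel = colouring⇒kernel {A[_]} invariant⇒colouring invariant⇒twisted

      invariant-constant : (∀ e → jumps d e ≡ false) → ∀ z z′ → d z ≡ d z′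
      invariant-constant x≗0 z z′ = trans (value z) (sym (value z′))
        where
        value : ∀ z → d z ≡ c y₀
        value z = trans (cong d (sym (twist-involutive A z)))
                     (colouring-constant invariant⇒colouring x≗0 (τ z))

    module _ {x : Fin m → Bool} (ker : Kernelᴬ x) where

      kernelColouring : Flag m → Bool
      kernelColouring = h x ∘ τ

      kernel⇒invariant : Invariant boundary kernelColouring
      kernel⇒invariant (here refl) (e , false , s) = sym (kernel⇒colouring ker e s)
      kernel⇒invariant (here refl) (e , true  , s) = kernel⇒colouring ker e s
      kernel⇒invariant (there (here refl)) z = trans (cong (h x) (twist-involutive A (arc (τ z))))
        (IsColouring.arc-invariant (h-isColouring x) (τ z))

      kernelColouring-jump : ∀ z → kernelColouring (across z) ≡ kernelColouring z xor x (edgeOf z)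
      kernelColouring-jump z@(e , false , s) = IsColouring.across-jump (h-isColouring x) (τ z)
      kernelColouring-jump z@(e , true  , s) = trans (cong (h x) (τ-across z))
        (IsColouring.across-jump (h-isColouring x) (τ z))

      kernelColouring-flips : ∀ z → x (edgeOf z) ≡ true → kernelColouring z ≢ kernelColouring (across z)
      kernelColouring-flips z xₑ eq = ≢-xor-true {kernelColouring z}
        (trans eq (trans (kernelColouring-jump z) (cong (kernelColouring z xor_) xₑ)))

      kernelColouring-keeps : ∀ z → x (edgeOf z) ≡ false → kernelColouring (across z) ≡ kernelColouring z
      kernelColouring-keeps z xₑ = trans (kernelColouring-jump z)
        (trans (cong (kernelColouring z xor_) xₑ) (xor-identityʳ (kernelColouring z)))

    #boundaries≥1 : 1 ≤ #boundaries
    #boundaries≥1 = #orbits≥1 boundary y₀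

    apart-via : ∀ {d} → Invariant boundary d → ∀ {z z′} → d z ≢ d z′ → Apart boundary z z′
    apart-via = invariant-apart boundary

    -- The jumps of the indicator of a boundary component lie in the kernel, hence vanish, and the
    -- indicator is constant.
    nonsingular⇒#boundaries≡1 : Nonsingular matrix A[_] (allFin m) → #boundaries ≡ 1
    nonsingular⇒#boundaries≡1 nonsing = ≤-antisym (≮⇒≥ λ 2≤ →
      case #orbits≥2⇒apart boundary 2≤ of λ (z , z′ , apart) → apart (related z z′)) #boundaries≥1
      where
      related : ∀ z z′ → SameOrbit boundary z z′
      related z z′ = orbitOf-true boundary (trans
        (invariant-constant inv (λ e → nonsing _ (invariant⇒kernel inv) (∈-allFin e)) z z′)
        (orbitOf-self boundary z′))
        where
        inv : Invariant boundary (orbitOf boundary z′)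
        inv = orbitOf-invariant boundary z′

    kernel⇒#boundaries≥2 : ∀ {x e} → Kernelᴬ x → x e ≡ true → 2 ≤ #boundaries
    kernel⇒#boundaries≥2 {x} {e} ker xₑ = apart⇒≤#orbits boundary {z ∷ across z ∷ []}
      ((jump ∷ []) ∷ [] ∷ [])
      where
      z : Flag m
      z = e , false , false
      jump : Apart boundary z (across z)
      jump = apart-via (kernel⇒invariant ker) (kernelColouring-flips ker z xₑ)

    -- Colourings with jumps x and y together distinguish the two sides of
    -- the edge i, and one side of j from both.
    corank≥2⇒#boundaries≥3 : ∀ {x y i j} → Kernelᴬ x → Kernelᴬ y →
      x i ≡ true → y i ≡ false → y j ≡ true → 3 ≤ #boundaries
    corank≥2⇒#boundaries≥3 {x} {y} {i} {j} kx ky xᵢ yᵢ yⱼ =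
      case third of λ (u , u≢z) → apart⇒≤#orbits boundary {z ∷ across z ∷ u ∷ []}
        ((x-jump ∷ apart-via (kernel⇒invariant ky) (u≢z ∘ sym) ∷ [])
          ∷ (apart-via (kernel⇒invariant ky) (λ eq → u≢z (trans (sym eq) y-same)) ∷ []) ∷ [] ∷ [])
      where
      z w : Flag m
      z = i , false , false
      w = j , false , false
      cx cy : Flag m → Bool
      cx = kernelColouring kx
      cy = kernelColouring ky
      x-jump : Apart boundary z (across z)
      x-jump = apart-via (kernel⇒invariant kx) (kernelColouring-flips kx z xᵢ)
      y-same : cy (across z) ≡ cy z
      y-same = kernelColouring-keeps ky z yᵢ
      third : ∃[ u ] cy u ≢ cy z
      third with cy w ≟ᵇ cy z
      ... | no w≢z  = w , w≢z
      ... | yes w≡z = across w , λ eq → kernelColouring-flips ky w yⱼ (trans w≡z (sym eq))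

    -- Among the indicators of two of three boundary components and their
    -- sum, one does not jump at e.
    determined⇒#boundaries≤2 : ∀ e → (∀ {x} → Kernelᴬ x → x e ≡ false → ∀ i → x i ≡ false) →
                               #boundaries ≤ 2
    determined⇒#boundaries≤2 e determined = ≮⇒≥ λ 3≤ →
      case #orbits≥3⇒apart boundary 3≤ of λ (z₁ , z₂ , z₃ , a₁₂ , a₁₃ , a₂₃) →
        contradict z₁ z₂ z₃ a₁₂ a₁₃ a₂₃
      where
      constant : ∀ {d} → Invariant boundary d → jumps d e ≡ false → ∀ z z′ → d z ≡ d z′
      constant inv xₑ = invariant-constant inv (determined (invariant⇒kernel inv) xₑ)

      contradict : ∀ z₁ z₂ z₃ → Apart boundary z₁ z₂ → Apart boundary z₁ z₃ →
                   Apart boundary z₂ z₃ → ⊥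
      contradict z₁ z₂ z₃ a₁₂ a₁₃ a₂₃ = cases (jumps d₁ e) (jumps d₂ e) refl refl
        where
        d₁ d₂ d : Flag m → Bool
        d₁ = orbitOf boundary z₁
        d₂ = orbitOf boundary z₂
        d z = d₁ z xor d₂ z
        inv₁ : Invariant boundary d₁
        inv₁ = orbitOf-invariant boundary z₁
        inv₂ : Invariant boundary d₂
        inv₂ = orbitOf-invariant boundary z₂
        differ : ∀ {b b′} → b ≡ true → b′ ≡ false → b ≢ b′
        differ refl refl ()
        d₁z₃ : d₁ z₃ ≡ false
        d₁z₃ = orbitOf-apart boundary (apart-sym boundary a₁₃)
        d₂z₃ : d₂ z₃ ≡ false
        d₂z₃ = orbitOf-apart boundary (apart-sym boundary a₂₃)
        jumps-d : jumps d e ≡ jumps d₁ e xor jumps d₂ e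
        jumps-d = solve 4 (λ a b a′ b′ → (a :+ b) :+ (a′ :+ b′) := (a :+ a′) :+ (b :+ b′)) refl
          (d₁ (e , false , false)) (d₂ (e , false , false)) (d₁ (e , false , true)) (d₂ (e , false , true))
          where open xor-∧-Solver
        cases : ∀ b₁ b₂ → jumps d₁ e ≡ b₁ → jumps d₂ e ≡ b₂ → ⊥
        cases false _     j₁ _  = differ (orbitOf-self boundary z₁) d₁z₃ (constant inv₁ j₁ z₁ z₃)
        cases true  false _  j₂ = differ (orbitOf-self boundary z₂) d₂z₃ (constant inv₂ j₂ z₂ z₃)
        cases true  true  j₁ j₂ = differ
          (cong₂ _xor_ (orbitOf-self boundary z₁) (orbitOf-apart boundary a₁₂)) (cong₂ _xor_ d₁z₃ d₂z₃)
          (constant {d} (λ g∈ z → cong₂ _xor_ (inv₁ g∈ z) (inv₂ g∈ z))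
                    (trans jumps-d (cong₂ _xor_ j₁ j₂)) z₁ z₃)

-- The partial Petrial polynomial

≅-sym : ∀ {m n} (G : SimpleGraph m) (H : SimpleGraph n) → G ≅ H → H ≅ G
≅-sym G H (φ , adj) = ↔-sym φ , λ u v →
  subst₂ (λ u′ v′ → Adj H u′ v′ ⇔ _) (Inverse.strictlyInverseˡ φ u) (Inverse.strictlyInverseˡ φ v)
    (⇔-sym (adj (Inverse.from φ u) (Inverse.from φ v)))

≅-trans : ∀ {l m n} (G : SimpleGraph l) (H : SimpleGraph m) (K : SimpleGraph n) →
          G ≅ H → H ≅ K → G ≅ K
≅-trans _ _ _ (φ , adj) (ψ , adj′) = ψ ↔-∘ φ , λ u v → adj′ (Inverse.to φ u) (Inverse.to φ v) ⇔-∘ adj u v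

genusPolynomial : {A : Set} → (A → ℤ) → List A → Polynomial
genusPolynomial ε l = foldr _⊕_ 𝟘 (map (λ a → 1 ·z^ ε a) l)

module _ {A : Set} (ε : A → ℤ) where

  coefficient-∈ : ∀ {l a} → a ∈ l → genusPolynomial ε l (ε a) ≢ 0
  coefficient-∈ {a ∷ l} (here refl) eq
    with () ← trans (sym (cong (λ b → (if b then 1 else 0) + genusPolynomial ε l (ε a))
                     (dec-true (ε a ℤ.≟ ε a) refl))) eq
  coefficient-∈ {b ∷ l} {a} (there a∈l) eq =
    coefficient-∈ a∈l (m+n≡0⇒n≡0 ((1 ·z^ ε b) (ε a)) eq)

  coefficient-support : ∀ l {j} → genusPolynomial ε l j ≢ 0 → Any (λ a → ε a ≡ j) l
  coefficient-support []      ≢0 = contradiction refl ≢0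
  coefficient-support (a ∷ l) {j} ≢0 with j ℤ.≟ ε a
  ... | yes j≡ = here (sym j≡)
  ... | no _   = there (coefficient-support l ≢0)

  coefficient-∉ : ∀ l {j} → (∀ a → ε a ≢ j) → genusPolynomial ε l j ≡ 0
  coefficient-∉ l {j} avoid with genusPolynomial ε l j ≟ 0
  ... | yes ≡0 = ≡0
  ... | no ≢0  = ⊥-elim (avoid _ (proj₂ (Any.satisfied (coefficient-support l ≢0))))

  binomial-support : ∀ {l} → Binomial (genusPolynomial ε l) → ∃[ k ] ∃[ m ] k ≢ m ×
    Any (λ a → ε a ≡ k) l × Any (λ a → ε a ≡ m) l × (∀ {a} → a ∈ l → ε a ≡ k ⊎ ε a ≡ m)
  binomial-support {l} (a , k , b , m , a≢0 , b≢0 , k≢m , P≗) =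
    k , m , k≢m ,
    coefficient-support l (a≢0 ∘ at-k) ,
    coefficient-support l (b≢0 ∘ at-m) ,
    within
    where
    at-k : genusPolynomial ε l k ≡ 0 → a ≡ 0
    at-k eq with k ℤ.≟ k | P≗ k
    ... | yes _  | p = m+n≡0⇒m≡0 a (trans (sym p) eq)
    ... | no k≢k | _ = contradiction refl k≢k
    at-m : genusPolynomial ε l m ≡ 0 → b ≡ 0
    at-m eq with m ℤ.≟ m | P≗ m
    ... | yes _  | p = m+n≡0⇒n≡0 ((a ·z^ k) m) (trans (sym p) eq)
    ... | no m≢m | _ = contradiction refl m≢m
    within : ∀ {c} → c ∈ l → ε c ≡ k ⊎ ε c ≡ m
    within {c} c∈l with ε c ℤ.≟ k | ε c ℤ.≟ m | P≗ (ε c)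
    ... | yes p | _     | _ = inj₁ p
    ... | no _  | yes p | _ = inj₂ p
    ... | no _  | no _  | p = contradiction p (coefficient-∈ c∈l)

  binomial⇒¬three : ∀ {l} → Binomial (genusPolynomial ε l) → ∀ {a b c} → a ∈ l → b ∈ l → c ∈ l →
                    ε a ≢ ε b → ε b ≢ ε c → ε a ≢ ε c → ⊥
  binomial⇒¬three bin a∈ b∈ c∈ a≢b b≢c a≢c with binomial-support bin
  ... | k , m , _ , _ , _ , within with within a∈ | within b∈ | within c∈
  ... | inj₁ p | inj₁ q | _      = a≢b (trans p (sym q))
  ... | inj₂ p | inj₂ q | _      = a≢b (trans p (sym q))
  ... | inj₁ p | inj₂ q | inj₁ r = a≢c (trans p (sym r))
  ... | inj₁ p | inj₂ q | inj₂ r = b≢c (trans q (sym r))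
  ... | inj₂ p | inj₁ q | inj₁ r = b≢c (trans q (sym r))
  ... | inj₂ p | inj₁ q | inj₂ r = a≢c (trans p (sym r))

  -- The two coefficients are values of the polynomial itself; it matters only that they are
  -- nonzero.
  two⇒binomial : ∀ {l a b} → a ∈ l → b ∈ l → ε a ≢ ε b → (∀ c → ε c ≡ ε a ⊎ ε c ≡ ε b) →
                 Binomial (genusPolynomial ε l)
  two⇒binomial {l} {a} {b} a∈l b∈l a≢b two = P (ε a) , ε a , P (ε b) , ε b ,
    coefficient-∈ a∈l , coefficient-∈ b∈l , a≢b , agree
    where
    P : Polynomial
    P = genusPolynomial ε l
    agree : ∀ j → P j ≡ (P (ε a) ·z^ ε a ⊕ P (ε b) ·z^ ε b) j
    agree j with j ℤ.≟ ε a | j ℤ.≟ ε b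
    ... | yes p    | yes q    = contradiction (trans (sym p) q) a≢b
    ... | yes refl | no _     = sym (+-identityʳ _)
    ... | no _     | yes refl = refl
    ... | no j≢a   | no j≢b   = coefficient-∉ l λ c → λ { refl →
                                  case two c of λ { (inj₁ p) → j≢a p ; (inj₂ p) → j≢b p } }

∈-subsets : ∀ {m} (A : Subset m) → A ∈ subsets m
∈-subsets Vec.[]            = here refl
∈-subsets (false Vec.∷ A)   = ∈-++⁺ˡ (∈-map⁺ _ (∈-subsets A))
∈-subsets (true  Vec.∷ A)   = ∈-++⁺ʳ _ (∈-map⁺ _ (∈-subsets A))

-- Toggling the elements one at a time, Q changes from true to false at some step.
switch : ∀ {m} {Q : Subset m → Set} → Decidable Q → ∀ A B → Q A → ¬ Q B →
  ∃[ C ] ∃[ C′ ] ∃[ e ] Q C × ¬ Q C′ × (∀ i → i ≢ e → Vec.lookup C i ≡ Vec.lookup C′ i)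
switch Q? Vec.[]       Vec.[]       qA ¬qB = contradiction qA ¬qB
switch Q? (a Vec.∷ A) (b Vec.∷ B) qA ¬qB with Q? (b Vec.∷ A)
... | no ¬q = a Vec.∷ A , b Vec.∷ A , zero , qA , ¬q ,
      λ { zero i≢e → contradiction refl i≢e ; (suc i) _ → refl }
... | yes q with switch (Q? ∘ (b Vec.∷_)) A B q ¬qB
... | C , C′ , e , qC , ¬qC′ , same = b Vec.∷ C , b Vec.∷ C′ , suc e , qC , ¬qC′ ,
      λ { zero _ → refl ; (suc i) i≢e → same i (i≢e ∘ cong suc) }

module _ {V : Set} {M : Matrix V} where

  line-lookup⁺ : ∀ {l} → Line M l → ∀ i j → toℕ j ≡ suc (toℕ i) → M (lookup l i) (lookup l j) ≡ true
  line-lookup⁺ (link uv _ _)    zero    (suc zero) _  = uv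
  line-lookup⁺ (link _ _ line)  (suc i) (suc j)    eq = line-lookup⁺ line i j (suc-injective eq)
  line-lookup⁺ (single _) zero zero ()

  line-lookup⁻ : ∀ {l} → Line M l → ∀ i j → toℕ i < toℕ j → M (lookup l i) (lookup l j) ≡ true →
                 toℕ j ≡ suc (toℕ i)
  line-lookup⁻ (link _ _ _) zero (suc zero) _ _ = refl
  line-lookup⁻ (link {l = l} _ ul _) zero (suc (suc j)) _ eq
    with () ← trans (sym eq) (All.lookup ul (∈-lookup {xs = l} j))
  line-lookup⁻ (link _ _ line) (suc i) (suc j) (s<s i<j) eq = cong suc (line-lookup⁻ line i j i<j eq)
  line-lookup⁻ (single _) zero zero ()

  line-lookup : SymmetricMatrix M → ∀ {l} → Line M l → ∀ i j →
    (i ≢ j × M (lookup l i) (lookup l j) ≡ true) ⇔ Adj (pathGraph (length l)) i j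
  line-lookup M-sym {l} line i j = mk⇔ to from
    where
    to : i ≢ j × M (lookup l i) (lookup l j) ≡ true → Adj (pathGraph (length l)) i j
    to (i≢j , eq) with <-cmp (toℕ i) (toℕ j)
    ... | tri< i<j _ _ = inj₁ (line-lookup⁻ line i j i<j eq)
    ... | tri≈ _ i≡j _ = contradiction (toℕ-injective i≡j) i≢j
    ... | tri> _ _ j<i = inj₂ (line-lookup⁻ line j i j<i (trans (M-sym _ _) eq))
    from : Adj (pathGraph (length l)) i j → i ≢ j × M (lookup l i) (lookup l j) ≡ true
    from adj = (λ { refl → SimpleGraph.irrefl (pathGraph (length l)) {i} adj }) , entry adj
      where
      entry : Adj (pathGraph (length l)) i j → M (lookup l i) (lookup l j) ≡ true
      entry (inj₁ j≡1+i) = line-lookup⁺ line i j j≡1+i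
      entry (inj₂ i≡1+j) = trans (M-sym _ _) (line-lookup⁺ line j i i≡1+j)

-- Genera of the partial Petrials of a bouquet with an edge

module _ (B : Bouquet) (y₀ : Flag (Bouquet.edges B)) where

  open NonemptyBouquet B y₀
  open Bouquet B using (Interlaced)

  F : Subset m → ℕ
  F A = Twisted.#boundaries A

  ε : Subset m → ℤ
  ε A = eulerGenus (partialPetrial R A)

  ε-cong : ∀ A A′ → F A ≡ F A′ → ε A ≡ ε A′
  ε-cong A A′ eq = trans (Twisted.genus-formula A)
    (trans (cong (λ f → + 2 ℤ.- (+ 1 ℤ.- + m ℤ.+ + f)) eq) (sym (Twisted.genus-formula A′)))

  ε-injective : ∀ A A′ → ε A ≡ ε A′ → F A ≡ F A′
  ε-injective A A′ eq = ℤ.+-injective (ℤ-cancelˡ (+ 1 ℤ.- + m) _ _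
    (ℤ.neg-injective (ℤ-cancelˡ (+ 2) _ _
      (trans (sym (Twisted.genus-formula A)) (trans eq (Twisted.genus-formula A′))))))

  interlaced⇔matrix : ∀ e f → Interlaced e f ⇔ (e ≢ f × matrix e f ≡ true)
  interlaced⇔matrix e f = mk⇔
    (λ { (e≢f , inj₁ alt) → e≢f , alternating⇒matrix e≢f alt
       ; (e≢f , inj₂ alt) → e≢f , trans (matrix-sym e f) (alternating⇒matrix (e≢f ∘ sym) alt) })
    (λ (e≢f , eq) → e≢f , inj₁ (matrix⇒alternating e≢f eq))

  kernel-resp : ∀ {D D′ x} → (∀ i → D i ∧ x i ≡ D′ i ∧ x i) →
                Kernel matrix D (allFin m) x → Kernel matrix D′ (allFin m) x
  kernel-resp {D} {D′} {x} same ker {i} i∈ =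
    trans (cong (⨁ (allFin m) (λ j → matrix i j ∧ x j) xor_) (sym (same i))) (ker i∈)

  kernel-tabulate : ∀ {D x} → Kernel matrix D (allFin m) x →
                    Twisted.Kernelᴬ (Vec.tabulate D) x
  kernel-tabulate {D} {x} = kernel-resp λ i → cong (_∧ x i) (sym (lookup∘tabulate D i))

  ∃-one-boundary : ∃[ A ] F A ≡ 1
  ∃-one-boundary with ∃-nonsingular _≟ⁿ_ matrix (allFin⁺ m)
  ... | D , nonsing = Vec.tabulate D ,
        Twisted.nonsingular⇒#boundaries≡1 (Vec.tabulate D) λ x ker →
          nonsing x (kernel-resp (λ i → cong (_∧ x i) (lookup∘tabulate D i)) ker)

  -- The Laplacian annihilates the all-one vector, so the maximal genus, attained with one boundary
  -- component, is never the only one.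
  ∃-two-boundaries : ∃[ A ] 2 ≤ F A
  ∃-two-boundaries = Vec.tabulate D ,
    Twisted.kernel⇒#boundaries≥2 (Vec.tabulate D) {λ _ → true} {edgeOf y₀}
      (kernel-tabulate {D} {λ _ → true} (kernel-locallyConstant {M = matrix} (λ _ _ _ → refl))) refl
    where
    D : Fin m → Bool
    D i = ⨁ (allFin m) (matrix i)

  -- The toggle found by `switch` supplies the counts 1 and 2: it ends below 2, and it starts at 2
  -- because one toggle lowers the count by at most one. Together with `A₃` this makes three genera.
  corank≥2⇒¬binomial : Corank≥2 matrix (allFin m) → ¬ Binomial (petrialPolynomial R)
  corank≥2⇒¬binomial corank bin =
    case switch (λ A → 2 ≤? F A) A₃ A₁ (≤-trans (n≤1+n 2) F₃) (λ 2≤ → <⇒≱ 2≤ (≤-reflexive F₁)) of λ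
      (C , C′ , e , 2≤FC , FC′≱2 , same) → let
        F≡1 = ≤-antisym (≤-pred (≰⇒> FC′≱2)) (Twisted.#boundaries≥1 C′)
        F≡2 = ≤-antisym (FC≤2 C C′ e FC′≱2 same) 2≤FC
      in binomial⇒¬three ε bin (∈-subsets C′) (∈-subsets C) (∈-subsets A₃)
           (λ eq → case trans (sym F≡1) (trans (ε-injective C′ C eq) F≡2) of λ ())
           (λ eq → <⇒≱ F₃ (≤-reflexive (trans (sym (ε-injective C A₃ eq)) F≡2)))
           (λ eq → <⇒≱ F₃ (≤-trans (≤-reflexive (trans (sym (ε-injective C′ A₃ eq)) F≡1)) (n≤1+n 1)))
    where
    open Corank≥2 corank
    A₁ A₃ : Subset m
    A₁ = proj₁ ∃-one-boundary
    A₃ = Vec.tabulate D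
    F₁ : F A₁ ≡ 1
    F₁ = proj₂ ∃-one-boundary
    F₃ : 3 ≤ F A₃
    F₃ = Twisted.corank≥2⇒#boundaries≥3 A₃
      (kernel-tabulate {D} {x} x-kernel) (kernel-tabulate {D} {y} y-kernel) xᵢ yᵢ yⱼ
    -- A kernel vector of C vanishing at e is one of C′, hence zero.
    FC≤2 : ∀ C C′ e → ¬ 2 ≤ F C′ → (∀ i → i ≢ e → Vec.lookup C i ≡ Vec.lookup C′ i) → F C ≤ 2
    FC≤2 C C′ e FC′≱2 same = Twisted.determined⇒#boundaries≤2 C e λ {x} ker xₑ i →
      ¬-not λ xᵢ → FC′≱2 (Twisted.kernel⇒#boundaries≥2 C′ (kernel-resp (agree x xₑ) ker) xᵢ)
      where
      agree : ∀ x → x e ≡ false → ∀ i → Vec.lookup C i ∧ x i ≡ Vec.lookup C′ i ∧ x i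
      agree x xₑ i with i ≟ⁿ e
      ... | no i≢e   = cong (_∧ x i) (same i i≢e)
      ... | yes refl = trans (cong (Vec.lookup C i ∧_) xₑ) (trans (∧-zeroʳ _)
                         (sym (trans (cong (Vec.lookup C′ i ∧_) xₑ) (∧-zeroʳ _))))

  linear⇒path : Linear matrix (allFin m) → ∃[ k ] k ≥ 1 × intersectionGraph B ≅ pathGraph k
  linear⇒path (q , q↭ , line) = length q , nonempty line , ≅-sym (pathGraph (length q)) (intersectionGraph B) (φ , adj)
    where
    nonempty : ∀ {q} → Line matrix q → length q ≥ 1
    nonempty (single _)   = s≤s z≤n
    nonempty (link _ _ _) = s≤s z≤n
    ∈q : ∀ e → e ∈ q
    ∈q e = ∈-resp-↭ (↭-sym q↭) (∈-allFin e)
    lookup-injective : ∀ {i j} → lookup q i ≡ lookup q j → i ≡ j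
    lookup-injective {i} {j} eq with i ≟ⁿ j
    ... | yes i≡j = i≡j
    ... | no i≢j  = contradiction eq
      (allPairs-lookup (_∘ sym) (unique-resp-↭ (↭-sym q↭) (allFin⁺ m)) i≢j)
    lookup-index : ∀ e → lookup q (Any.index (∈q e)) ≡ e
    lookup-index e = sym (Any.lookup-index (∈q e))
    φ : Fin (length q) ↔ Fin m
    φ = mk↔ₛ′ (lookup q) (Any.index ∘ ∈q) lookup-index (λ i → lookup-injective (lookup-index (lookup q i)))
    adj : ∀ i j → Adj (pathGraph (length q)) i j ⇔ Interlaced (lookup q i) (lookup q j)
    adj i j = ⇔-sym (interlaced⇔matrix _ _)
      ⇔-∘ (mk⇔ (λ (i≢j , eq) → i≢j ∘ lookup-injective , eq) (λ (e≢f , eq) → e≢f ∘ cong (lookup q) , eq)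
        ⇔-∘ ⇔-sym (line-lookup matrix-sym line i j))

  binomial⇒path : Binomial (petrialPolynomial R) → ∃[ k ] k ≥ 1 × intersectionGraph B ≅ pathGraph k
  binomial⇒path bin with dichotomy _≟ⁿ_ (pred m) matrix-sym (allFin⁺ m)
                           (trans (length-tabulate id) (sym (m≡suc (edgeOf y₀))))
    where
    m≡suc : ∀ {m} → Fin m → suc (pred m) ≡ m
    m≡suc zero    = refl
    m≡suc (suc _) = refl
  ... | inj₁ corank = contradiction bin (corank≥2⇒¬binomial corank)
  ... | inj₂ linear = linear⇒path linear

  -- Row i of the kernel equation expresses the (i+1)-st entry along the path
  -- by the preceding ones.
  path⇒determined : ∀ {k} (iso : intersectionGraph B ≅ pathGraph (suc k)) A {x} → Twisted.Kernelᴬ A x →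
                    x (Inverse.from (proj₁ iso) zero) ≡ false → ∀ i → x i ≡ false
  path⇒determined {k} (φ , adj) A {x} ker x₀ i =
    subst (λ i → x i ≡ false) (Inverse.strictlyInverseʳ φ i) (vanish (toℕ (to i)) (to i) ≤-refl)
    where
    open Inverse φ using (to; from; strictlyInverseˡ; strictlyInverseʳ)

    adjacent : ∀ e f → matrix e f ≡ true → e ≢ f → Adj (pathGraph (suc k)) (to e) (to f)
    adjacent e f eq e≢f = Equivalence.to (adj e f) (Equivalence.from (interlaced⇔matrix e f) (e≢f , eq))

    -- The bound `b` makes the induction strong: the row of the vertex at position `b` also involves
    -- its predecessor.
    vanish : ∀ b t → toℕ t ≤ b → x (from t) ≡ false
    vanish zero    zero _ = x₀
    vanish (suc b) t t≤1+b with m≤n⇒m<n∨m≡n t≤1+b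
    ... | inj₁ t<1+b = vanish b t (≤-pred t<1+b)
    ... | inj₂ t≡1+b = begin
      x q                                                      ≡⟨ cong (_∧ x q) pq ⟨
      matrix p q ∧ x q                                         ≡⟨ ⨁-single (allFin⁺ m) (∈-allFin q) (λ {j} _ → other j) ⟨
      ⨁ (allFin m) (λ j → matrix p j ∧ x j)                    ≡⟨ xor-identityʳ _ ⟨
      ⨁ (allFin m) (λ j → matrix p j ∧ x j) xor false          ≡⟨ cong (⨁ (allFin m) (λ j → matrix p j ∧ x j) xor_) diagonal ⟨
      row matrix (Vec.lookup A) (allFin m) x p                 ≡⟨ ker (∈-allFin p) ⟩
      false                                                    ∎
      where
      open ≡-Reasoning
      b<1+k : b < suc k
      b<1+k = <-trans (n<1+n b) (subst (_< suc k) t≡1+b (toℕ<n t))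
      s : Fin (suc k)
      s = fromℕ< b<1+k
      s≡b : toℕ s ≡ b
      s≡b = toℕ-fromℕ< b<1+k
      p q : Fin m
      p = from s
      q = from t
      xₚ : x p ≡ false
      xₚ = vanish b s (≤-reflexive s≡b)
      diagonal : Vec.lookup A p ∧ x p ≡ false
      diagonal = trans (cong (Vec.lookup A p ∧_) xₚ) (∧-zeroʳ _)
      pq : matrix p q ≡ true
      pq = proj₂ (Equivalence.to (interlaced⇔matrix p q) (Equivalence.from (adj p q)
        (inj₁ (trans (cong toℕ (strictlyInverseˡ t))
          (trans t≡1+b (cong suc (trans (sym s≡b) (cong toℕ (sym (strictlyInverseˡ s))))))))))
      neighbour : ∀ j → j ≢ q → Adj (pathGraph (suc k)) (to p) (to j) → x j ≡ false
      neighbour j j≢q (inj₁ j≡1+p) = contradiction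
        (trans (sym (strictlyInverseʳ j)) (cong from (toℕ-injective
          (trans j≡1+p (trans (cong suc (trans (cong toℕ (strictlyInverseˡ s)) s≡b)) (sym t≡1+b))))))
        j≢q
      neighbour j _ (inj₂ p≡1+j) = subst (λ j → x j ≡ false) (strictlyInverseʳ j)
        (vanish b (to j) (≤-trans (n≤1+n _) (≤-reflexive
          (trans (sym p≡1+j) (trans (cong toℕ (strictlyInverseˡ s)) s≡b)))))
      other : ∀ j → j ≢ q → matrix p j ∧ x j ≡ false
      other j j≢q with matrix p j in eq
      ... | false = refl
      ... | true with p ≟ⁿ j
      ... | yes refl = xₚ
      ... | no p≢j   = neighbour j j≢q (adjacent p j eq p≢j)

  path⇒binomial : ∀ {k} → intersectionGraph B ≅ pathGraph (suc k) → Binomial (petrialPolynomial R)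
  path⇒binomial iso = two⇒binomial ε (∈-subsets A₁) (∈-subsets A₂)
    (λ eq → <⇒≢ F₂ (trans (sym F₁) (ε-injective A₁ A₂ eq))) two
    where
    A₁ A₂ : Subset m
    A₁ = proj₁ ∃-one-boundary
    A₂ = proj₁ ∃-two-boundaries
    F₁ : F A₁ ≡ 1
    F₁ = proj₂ ∃-one-boundary
    F₂ : 2 ≤ F A₂
    F₂ = proj₂ ∃-two-boundaries
    F≤2 : ∀ A → F A ≤ 2
    F≤2 A = Twisted.determined⇒#boundaries≤2 A _ (path⇒determined iso A)
    two : ∀ A → ε A ≡ ε A₁ ⊎ ε A ≡ ε A₂
    two A with m≤n⇒m<n∨m≡n (F≤2 A)
    ... | inj₁ F<2 = inj₁ (ε-cong A A₁ (trans (≤-antisym (≤-pred F<2) (Twisted.#boundaries≥1 A)) (sym F₁)))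
    ... | inj₂ F≡2 = inj₂ (ε-cong A A₂ (trans F≡2 (sym (≤-antisym (F≤2 A₂) F₂))))

-- Separates off the bouquet without edges, which has no flag to serve as base point; its polynomial
-- has one summand and is not binomial.
nonempty-or-unique : ∀ m → Fin m ⊎ (∀ (A A′ : Subset m) → A ≡ A′)
nonempty-or-unique zero    = inj₂ λ { Vec.[] Vec.[] → refl }
nonempty-or-unique (suc m) = inj₁ zero

theorem6 : (n : ℕ) (G : SimpleGraph n) → Connected G → (circle : IsCircleGraph G) →
    Binomial (circleGraphPolynomial G circle) ⇔ IsPath G
theorem6 n G _ (B , B≅G) = mk⇔ to from
  where
  I : SimpleGraph (Bouquet.edges B)
  I = intersectionGraph B

  genus : Subset (Bouquet.edges B) → ℤ
  genus A = eulerGenus (partialPetrial (Bouquet.ribbonGraph B) A)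

  to : Binomial (petrialPolynomial (Bouquet.ribbonGraph B)) → IsPath G
  to bin with nonempty-or-unique (Bouquet.edges B)
  ... | inj₁ e = case binomial⇒path B (e , false , false) bin of λ
          (k , k≥1 , iso) → k , k≥1 , ≅-trans G I (pathGraph k) (≅-sym I G B≅G) iso
  ... | inj₂ unique with binomial-support genus {subsets _} bin
  ... | _ , _ , k≢m , some-k , some-m , _ with Any.satisfied some-k | Any.satisfied some-m
  ... | A , refl | A′ , refl = contradiction (cong genus (unique A A′)) k≢m

  from : IsPath G → Binomial (petrialPolynomial (Bouquet.ribbonGraph B))
  from (suc k , _ , G≅path) = path⇒binomial B (Inverse.from (proj₁ iso) zero , false , false) iso
    where
    iso : intersectionGraph B ≅ pathGraph (suc k)
    iso = ≅-trans I G (pathGraph (suc k)) B≅G G≅path
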